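{- Let $A \in \mathbb{F}_2[x]$ be an even, non-splitting polynomial all of whose odd irreducible divisors belong to $\mathcal{F}=\{M_1,\ldots,M_{13},S_1,\ldots,S_{15}\}$. Then $A$ is an indecomposable perfect polynomial if and only if $A, \overline{A} \in \{T_1, \ldots, T_{11}\}$.
   Context: All polynomials are in $\mathbb{F}_2[x]$. A nonzero polynomial is even if it has a linear factor ($x$ or $x+1$), and odd otherwise. $\sigma(A)$ denotes the sum of all monic divisors of $A$, and $\omega(A)$ the number of distinct irreducible factors of $A$. $A$ splits if $A$ is even and $\omega(A)\le 2$. $A$ is perfect if $\sigma(A)=A$. A perfect polynomial is indecomposable if it is not the product of two coprime nonconstant perfect polynomials. For $Q\in\mathbb{F}_2[x]$, $\overline{Q}(x)=Q(x+1)$. $M_1=1+x+x^2$, $M_2=1+x+x^3$, $M_3=1+x^2+x^3$, $M_4=1+x+x^2+x^3+x^4$, $M_5=1+x^3+x^4$, $M_6=1+x^3+x^5$, $M_7=1+x^3+x^7$, $M_8=1+x^6+x^7$, $M_9=\overline{M_6}$, $M_{10}=\overline{M_7}$, $M_{11}=\overline{M_8}$, $M_{12}=1+x+x^9$, $M_{13}=1+x^8+x^9$. $S_1=1+x(x+1)M_1$, $S_2=1+x^2(x+1)^2M_1$, $S_3=1+x(x+1)^3M_1^4$, $S_4=1+x^3(x+1)M_1$, $S_5=1+x(x+1)^3M_1$, $S_6=1+x^3(x+1)M_1^4$, $S_7=1+x(x+1)M_1^3$, $S_8=1+x^3(x+1)^3M_1$, $S_9=1+x(x+1)M_1^5$,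 $S_{10}=1+x^4(x+1)M_1$, $S_{11}=1+x(x+1)^2M_1$, $S_{12}=1+x^2(x+1)M_1^2$, $S_{13}=1+x(x+1)^4M_1$, $S_{14}=1+x^2(x+1)M_1$, $S_{15}=1+x(x+1)^2M_1^2$. $T_1=x^2(x+1)M_1$, $T_2=\overline{T_1}$, $T_3=x^4(x+1)^3M_4$, $T_4=\overline{T_3}$, $T_5=x^4(x+1)^4M_4\overline{M_4}$, $T_6=x^6(x+1)^3M_2\overline{M_2}$, $T_7=\overline{T_6}$, $T_8=x^4(x+1)^6M_2\overline{M_2}M_4$, $T_9=\overline{T_8}$, $T_{10}=x^2(x+1)M_1^2(1+x+x^4)$, $T_{11}=\overline{T_{10}}$. -}

module Defs where

open import Data.Nat using (ℕ; zero; suc; _≤_)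
open import Data.List using (List; []; _∷_; foldr; length)
open import Data.List.Membership.Propositional using (_∈_)
open import Data.List.Relation.Unary.Unique.Propositional using (Unique)
open import Data.Product using (Σ; ∃; _×_; _,_)
open import Data.Sum using (_⊎_)
open import Relation.Binary.PropositionalEquality using (_≡_; _≢_)
open import Relation.Nullary using (¬_)
open import Function.Bundles using (_⇔_)

-- Polynomials over 𝔽₂, canonical representation.
-- A nonzero polynomial is a bit string (constant term first) whose
-- leading coefficient 1 is implicit:
--   one    = 1
--   c0 p   = x·p
--   c1 p   = 1 + x·p
-- Every element of 𝔽₂[x] has exactly one representative, so _≡_ is
-- equality of polynomials.

data P⁺ : Set where
  one : P⁺
  c0  : P⁺ → P⁺
  c1  : P⁺ → P⁺

data Poly : Set where
  0ₚ  : Poly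
  ⟨_⟩ : P⁺ → Poly

1ₚ : Poly
1ₚ = ⟨ one ⟩

shift : Poly → Poly
shift 0ₚ    = 0ₚ
shift ⟨ p ⟩ = ⟨ c0 p ⟩

cons1 : Poly → Poly
cons1 0ₚ    = ⟨ one ⟩
cons1 ⟨ p ⟩ = ⟨ c1 p ⟩

add⁺ : P⁺ → P⁺ → Poly
add⁺ one    one    = 0ₚ
add⁺ one    (c0 q) = ⟨ c1 q ⟩
add⁺ one    (c1 q) = ⟨ c0 q ⟩
add⁺ (c0 p) one    = ⟨ c1 p ⟩
add⁺ (c1 p) one    = ⟨ c0 p ⟩
add⁺ (c0 p) (c0 q) = shift (add⁺ p q)
add⁺ (c0 p) (c1 q) = cons1 (add⁺ p q)
add⁺ (c1 p) (c0 q) = cons1 (add⁺ p q)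
add⁺ (c1 p) (c1 q) = shift (add⁺ p q)

infixl 6 _+_
infixl 7 _*_
infixr 8 _^_

_+_ : Poly → Poly → Poly
0ₚ    + q     = q
⟨ p ⟩ + 0ₚ    = ⟨ p ⟩
⟨ p ⟩ + ⟨ q ⟩ = add⁺ p q

mul⁺ : P⁺ → Poly → Poly
mul⁺ one    q = q
mul⁺ (c0 p) q = shift (mul⁺ p q)
mul⁺ (c1 p) q = q + shift (mul⁺ p q)

_*_ : Poly → Poly → Poly
0ₚ    * q = 0ₚ
⟨ p ⟩ * q = mul⁺ p q

_^_ : Poly → ℕ → Poly
p ^ zero  = 1ₚ
p ^ suc n = p * (p ^ n)

X : Poly
X = ⟨ c0 one ⟩

-- Q ↦ Q̄, Q̄(x) = Q(x+1)   (Horner evaluation at x+1)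
bar⁺ : P⁺ → Poly
bar⁺ one    = 1ₚ
bar⁺ (c0 p) = (X + 1ₚ) * bar⁺ p
bar⁺ (c1 p) = 1ₚ + (X + 1ₚ) * bar⁺ p

bar : Poly → Poly
bar 0ₚ    = 0ₚ
bar ⟨ p ⟩ = bar⁺ p

infix 4 _∣_
_∣_ : Poly → Poly → Set
B ∣ A = ∃ λ C → B * C ≡ A

-- leading coefficient 1; over 𝔽₂ this holds exactly for nonzero polynomials
Monic : Poly → Set
Monic A = A ≢ 0ₚ

NonConstant : Poly → Set
NonConstant A = A ≢ 0ₚ × A ≢ 1ₚ

-- the only unit of 𝔽₂[x] is 1
Irreducible : Poly → Set
Irreducible P = NonConstant P × (∀ B C → B * C ≡ P → B ≡ 1ₚ ⊎ C ≡ 1ₚ)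

Even : Poly → Set
Even A = A ≢ 0ₚ × (X ∣ A ⊎ (X + 1ₚ) ∣ A)

Odd : Poly → Set
Odd A = A ≢ 0ₚ × ¬ (X ∣ A) × ¬ ((X + 1ₚ) ∣ A)

sumₚ : List Poly → Poly
sumₚ = foldr _+_ 0ₚ

SigmaIs : Poly → Poly → Set
SigmaIs A S = Σ (List Poly) λ L →
  Unique L × (∀ D → D ∈ L ⇔ (Monic D × D ∣ A)) × sumₚ L ≡ S

OmegaIs : Poly → ℕ → Set
OmegaIs A n = Σ (List Poly) λ L →
  Unique L × (∀ P → P ∈ L ⇔ (Irreducible P × P ∣ A)) × length L ≡ n

Splits : Poly → Set
Splits A = Even A × ∃ λ n → OmegaIs A n × n ≤ 2

Perfect : Poly → Set
Perfect A = SigmaIs A A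

Coprime : Poly → Poly → Set
Coprime B C = ∀ D → Monic D → D ∣ B → D ∣ C → D ≡ 1ₚ

IndecomposablePerfect : Poly → Set
IndecomposablePerfect A = Perfect A ×
  ¬ (∃ λ B → ∃ λ C → A ≡ B * C × Coprime B C ×
       NonConstant B × NonConstant C × Perfect B × Perfect C)

x : Poly
x = X

x+1 : Poly
x+1 = X + 1ₚ

M₁ M₂ M₃ M₄ M₅ M₆ M₇ M₈ M₉ M₁₀ M₁₁ M₁₂ M₁₃ : Poly
M₁  = 1ₚ + x + x ^ 2
M₂  = 1ₚ + x + x ^ 3
M₃  = 1ₚ + x ^ 2 + x ^ 3
M₄  = 1ₚ + x + x ^ 2 + x ^ 3 + x ^ 4
M₅  = 1ₚ + x ^ 3 + x ^ 4
M₆  = 1ₚ + x ^ 3 + x ^ 5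
M₇  = 1ₚ + x ^ 3 + x ^ 7
M₈  = 1ₚ + x ^ 6 + x ^ 7
M₉  = bar M₆
M₁₀ = bar M₇
M₁₁ = bar M₈
M₁₂ = 1ₚ + x + x ^ 9
M₁₃ = 1ₚ + x ^ 8 + x ^ 9

S₁ S₂ S₃ S₄ S₅ S₆ S₇ S₈ S₉ S₁₀ S₁₁ S₁₂ S₁₃ S₁₄ S₁₅ : Poly
S₁  = 1ₚ + x * x+1 * M₁
S₂  = 1ₚ + x ^ 2 * x+1 ^ 2 * M₁
S₃  = 1ₚ + x * x+1 ^ 3 * M₁ ^ 4
S₄  = 1ₚ + x ^ 3 * x+1 * M₁
S₅  = 1ₚ + x * x+1 ^ 3 * M₁
S₆  = 1ₚ + x ^ 3 * x+1 * M₁ ^ 4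
S₇  = 1ₚ + x * x+1 * M₁ ^ 3
S₈  = 1ₚ + x ^ 3 * x+1 ^ 3 * M₁
S₉  = 1ₚ + x * x+1 * M₁ ^ 5
S₁₀ = 1ₚ + x ^ 4 * x+1 * M₁
S₁₁ = 1ₚ + x * x+1 ^ 2 * M₁
S₁₂ = 1ₚ + x ^ 2 * x+1 * M₁ ^ 2
S₁₃ = 1ₚ + x * x+1 ^ 4 * M₁
S₁₄ = 1ₚ + x ^ 2 * x+1 * M₁
S₁₅ = 1ₚ + x * x+1 ^ 2 * M₁ ^ 2

T₁ T₂ T₃ T₄ T₅ T₆ T₇ T₈ T₉ T₁₀ T₁₁ : Poly
T₁  = x ^ 2 * x+1 * M₁
T₂  = bar T₁
T₃  = x ^ 4 * x+1 ^ 3 * M₄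
T₄  = bar T₃
T₅  = x ^ 4 * x+1 ^ 4 * M₄ * bar M₄
T₆  = x ^ 6 * x+1 ^ 3 * M₂ * bar M₂
T₇  = bar T₆
T₈  = x ^ 4 * x+1 ^ 6 * M₂ * bar M₂ * M₄
T₉  = bar T₈
T₁₀ = x ^ 2 * x+1 * M₁ ^ 2 * (1ₚ + x + x ^ 4)
T₁₁ = bar T₁₀

𝓕 : List Poly
𝓕 = M₁ ∷ M₂ ∷ M₃ ∷ M₄ ∷ M₅ ∷ M₆ ∷ M₇ ∷ M₈ ∷ M₉ ∷ M₁₀ ∷ M₁₁ ∷ M₁₂ ∷ M₁₃ ∷
    S₁ ∷ S₂ ∷ S₃ ∷ S₄ ∷ S₅ ∷ S₆ ∷ S₇ ∷ S₈ ∷ S₉ ∷ S₁₀ ∷ S₁₁ ∷ S₁₂ ∷ S₁₃ ∷ S₁₄ ∷ S₁₅ ∷ []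

𝓣 : List Poly
𝓣 = T₁ ∷ T₂ ∷ T₃ ∷ T₄ ∷ T₅ ∷ T₆ ∷ T₇ ∷ T₈ ∷ T₉ ∷ T₁₀ ∷ T₁₁ ∷ []

{-# OPTIONS --safe #-}
-- Write A = ∏ Pʰ over the allowed primes P and h + 1 = 2ⁿu with u odd.  In characteristic 2,
-- σ(Pʰ) = (1 + P)^(2ⁿ - 1) σ(P^(u-1))^(2ⁿ).  If A is perfect, every irreducible factor Q of σ(P^(u-1))
-- is an allowed prime, and P modulo Q has order > 1 dividing u.  Iterating this with powers of P leaves
-- finitely many u for each P.  Comparing the exponents of both sides of σ(A) = A gives equations
-- 2ⁿu - 1 = (a sum of powers of 2) in which every prime but x, x + 1 and M₁ has few summands; as
-- 2ⁿu - 1 ends in n binary ones, this bounds n.  Unless u = 1 for both x and x + 1, which forces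
-- A = (x(x+1))ᵃ, all n are bounded, and the finitely many remaining systems are solved by evaluation.
-- In every solution with A ≠ 1 the polynomial x divides A, so none is a product of two coprime ones.
module Submission where

open import Algebra.Bundles using (CommutativeRing)
import Algebra.Properties.CommutativeSemigroup as CommutativeSemigroupₚ
open import Data.Bool using (Bool; true; false; if_then_else_; _xor_; T; _∧_; _∨_)
open import Data.Bool.ListAction using (all; any)
open import Data.Bool.Properties using (xor-comm; xor-assoc; xor-same; T?; T-≡; T-∧; T-∨)
open import Data.Empty using (⊥; ⊥-elim)
open import Data.Fin using (Fin; #_)
open import Data.List using (List; []; _∷_; _++_; map; foldr; lookup; drop; filter; length; upTo; cartesianProductWith)
open import Data.List.Membership.Propositional using (_∈_; find; lose)
open import Data.List.Membership.Propositional.Properties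
  using (∈-++⁺ˡ; ∈-++⁺ʳ; ∈-++⁻; ∈-map⁺; ∈-map⁻; ∈-lookup; ∈-filter⁺; ∈-filter⁻; ∈-upTo⁺; ∈-cartesianProductWith⁺)
open import Data.List.Membership.Propositional.Properties.WithK using (unique∧set⇒bag)
open import Data.List.Properties using (length-filter)
open import Data.List.Relation.Binary.BagAndSetEquality using (∼bag⇒↭)
open import Data.List.Relation.Binary.Permutation.Propositional using (↭⇒↭ₛ)
open import Data.List.Relation.Binary.Permutation.Setoid.Properties using (foldr-commMonoid)
open import Data.List.Relation.Unary.All as All using (All; []; _∷_; all?)
open import Data.List.Relation.Unary.All.Properties using (all⁺; all⁻; ¬Any⇒All¬)
open import Data.List.Relation.Unary.AllPairs using (AllPairs; []; _∷_; allPairs?)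
open import Data.List.Relation.Unary.Any as Any using (Any; here; there; any?)
open import Data.List.Relation.Unary.Any.Properties using (any⁺; any⁻)
open import Data.List.Relation.Unary.Unique.Propositional using (Unique)
import Data.List.Relation.Unary.Unique.Propositional.Properties as Uniqueₚ
open import Data.Maybe using (Maybe; just; nothing; maybe′; is-nothing)
open import Data.Nat as ℕ
  using (ℕ; zero; suc; _≤_; _<_; z≤n; s≤s; _<ᵇ_; _≡ᵇ_; _∸_; _%_; _/_; ⌊_/2⌋)
import Data.Nat.Properties as ℕₚ
open import Data.List.Membership.DecPropositional ℕ._≟_ using () renaming (_∈?_ to _∈ℕ?_)
open import Data.Nat.Coprimality using (coprime-Bézout) renaming (Coprime to Coprimeℕ)
open import Data.Nat.Divisibility using (divides) renaming (_∣_ to _∣ℕ_; _∣?_ to _∣ℕ?_)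
import Data.Nat.Divisibility as ℕ∣
open import Data.Nat.DivMod using (m≡m%n+[m/n]*n; m%n<n)
open import Data.Nat.GCD using (module Bézout)
open import Data.Nat.ListAction using (product)
open import Data.Nat.Primality using (prime?; prime⇒irreducible) renaming (Prime to Primeℕ)
open import Data.Product using (∃; _×_; _,_; proj₁; proj₂; map₁)
open import Data.Sum using (_⊎_; inj₁; inj₂)
open import Function using (_∘_; case_of_)
open import Function.Bundles using (_⇔_; mk⇔; Equivalence)
open import Relation.Binary.PropositionalEquality
open import Relation.Nullary using (¬_; Dec; yes; no)
open import Relation.Nullary.Decidable using (map′; toWitness; ¬?; _×-dec_; _⊎-dec_)

-- Every allowed prime has the form 1 + x^a (x+1)^b M₁^c, so the factor (1 + P)^(2^n - 1) of σ(P^h)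
-- feeds only x, x + 1 and M₁. The exponent of any other prime is thus a sum of powers of two, at
-- most one from each P; this is why it has few summands. M₁ comes next: the primes already bounded
-- contribute a small number, and x and x + 1 add at most one power of two each. The exponents of x
-- and x + 1 feed each other and admit no such bound, as (x(x+1))^(2^n - 1) is perfect for every n.
-- They are bounded from the other side: if u > 1 for one of them, its power of two reappears in an
-- exponent that is bounded already.
--
-- The values of u are limited by group orders: the units modulo an allowed prime of degree d have
-- order dividing 2^d - 1, and `oddPrimes` contains all prime factors of these numbers. So u is a
-- product of such primes, and the tables `good` and `bad` record where its growth must stop.
-- Polynomials enter the final search only through the tables; the search itself runs on natural
-- numbers.

module ExponentSystem where
  open import Data.Nat using (_+_; _*_; _^_)
  open CommutativeSemigroupₚ ℕₚ.+-commutativeSemigroup using (interchange)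


  -- The irreducible polynomials allowed to divide A: x₀ is x and x₁ is x + 1.
  data Prime : Set where
    x₀ x₁ : Prime
    m₁ m₂ m₃ m₄ m₅ m₆ m₇ m₈ m₉ m₁₀ m₁₁ m₁₂ m₁₃ : Prime
    s₁ s₂ s₃ s₄ s₅ s₆ s₇ s₈ s₉ s₁₀ s₁₁ s₁₂ s₁₃ s₁₄ s₁₅ : Prime

  primes : List Prime
  primes =
    x₀ ∷ x₁ ∷
    m₁ ∷ m₂ ∷ m₃ ∷ m₄ ∷ m₅ ∷ m₆ ∷ m₇ ∷ m₈ ∷ m₉ ∷ m₁₀ ∷ m₁₁ ∷ m₁₂ ∷ m₁₃ ∷
    s₁ ∷ s₂ ∷ s₃ ∷ s₄ ∷ s₅ ∷ s₆ ∷ s₇ ∷ s₈ ∷ s₉ ∷ s₁₀ ∷ s₁₁ ∷ s₁₂ ∷ s₁₃ ∷ s₁₄ ∷ s₁₅ ∷ []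

  index : Prime → Fin 30
  index x₀  = # 0
  index x₁  = # 1
  index m₁  = # 2
  index m₂  = # 3
  index m₃  = # 4
  index m₄  = # 5
  index m₅  = # 6
  index m₆  = # 7
  index m₇  = # 8
  index m₈  = # 9
  index m₉  = # 10
  index m₁₀ = # 11
  index m₁₁ = # 12
  index m₁₂ = # 13
  index m₁₃ = # 14
  index s₁  = # 15
  index s₂  = # 16
  index s₃  = # 17
  index s₄  = # 18
  index s₅  = # 19
  index s₆  = # 20
  index s₇  = # 21
  index s₈  = # 22
  index s₉  = # 23
  index s₁₀ = # 24
  index s₁₁ = # 25
  index s₁₂ = # 26
  index s₁₃ = # 27
  index s₁₄ = # 28
  index s₁₅ = # 29

  lookup-index : ∀ i → lookup primes (index i) ≡ i
  lookup-index x₀  = refl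
  lookup-index x₁  = refl
  lookup-index m₁  = refl
  lookup-index m₂  = refl
  lookup-index m₃  = refl
  lookup-index m₄  = refl
  lookup-index m₅  = refl
  lookup-index m₆  = refl
  lookup-index m₇  = refl
  lookup-index m₈  = refl
  lookup-index m₉  = refl
  lookup-index m₁₀ = refl
  lookup-index m₁₁ = refl
  lookup-index m₁₂ = refl
  lookup-index m₁₃ = refl
  lookup-index s₁  = refl
  lookup-index s₂  = refl
  lookup-index s₃  = refl
  lookup-index s₄  = refl
  lookup-index s₅  = refl
  lookup-index s₆  = refl
  lookup-index s₇  = refl
  lookup-index s₈  = refl
  lookup-index s₉  = refl
  lookup-index s₁₀ = refl
  lookup-index s₁₁ = refl
  lookup-index s₁₂ = refl
  lookup-index s₁₃ = refl
  lookup-index s₁₄ = refl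
  lookup-index s₁₅ = refl

  ∈-primes : ∀ i → i ∈ primes
  ∈-primes i = subst (_∈ primes) (lookup-index i) (∈-lookup {xs = primes} (index i))

  for-primes : ∀ {P : Prime → Set} → All P primes → ∀ i → P i
  for-primes ps i = All.lookup ps (∈-primes i)

  sumOver : List Prime → (Prime → ℕ) → ℕ
  sumOver is f = foldr (λ i n → f i + n) 0 is

  -- poly i = 1 + xᵃ (x+1)ᵇ M₁ᶜ for shape i = a , b , c
  shape : Prime → ℕ × ℕ × ℕ
  shape x₀  = 0 , 1 , 0
  shape x₁  = 1 , 0 , 0
  shape m₁  = 1 , 1 , 0
  shape m₂  = 1 , 2 , 0
  shape m₃  = 2 , 1 , 0
  shape m₄  = 1 , 3 , 0
  shape m₅  = 3 , 1 , 0
  shape m₆  = 3 , 2 , 0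
  shape m₇  = 3 , 4 , 0
  shape m₈  = 6 , 1 , 0
  shape m₉  = 2 , 3 , 0
  shape m₁₀ = 4 , 3 , 0
  shape m₁₁ = 1 , 6 , 0
  shape m₁₂ = 1 , 8 , 0
  shape m₁₃ = 8 , 1 , 0
  shape s₁  = 1 , 1 , 1
  shape s₂  = 2 , 2 , 1
  shape s₃  = 1 , 3 , 4
  shape s₄  = 3 , 1 , 1
  shape s₅  = 1 , 3 , 1
  shape s₆  = 3 , 1 , 4
  shape s₇  = 1 , 1 , 3
  shape s₈  = 3 , 3 , 1
  shape s₉  = 1 , 1 , 5
  shape s₁₀ = 4 , 1 , 1
  shape s₁₁ = 1 , 2 , 1
  shape s₁₂ = 2 , 1 , 2
  shape s₁₃ = 1 , 4 , 1
  shape s₁₄ = 2 , 1 , 1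
  shape s₁₅ = 1 , 2 , 2

  -- σ(P^(g-1)) is a product of allowed primes exactly for g ∈ good P.
  good : Prime → List ℕ
  good x₀ = 1 ∷ 3 ∷ 5 ∷ 7 ∷ 9 ∷ 13 ∷ 15 ∷ []
  good x₁ = 1 ∷ 3 ∷ 5 ∷ 7 ∷ 9 ∷ 13 ∷ 15 ∷ []
  good m₁ = 1 ∷ 3 ∷ 5 ∷ 7 ∷ 15 ∷ []
  good m₂ = 1 ∷ 3 ∷ []
  good m₃ = 1 ∷ 3 ∷ []
  good s₁ = 1 ∷ 3 ∷ []
  good s₂ = 1 ∷ 3 ∷ []
  good _  = 1 ∷ []

  -- The exponents g for which poly j divides σ(Pᵍ⁻¹), P = poly i; it then divides exactly once.
  hits : Prime → Prime → List ℕ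
  hits x₀ m₁ = 3 ∷ 9 ∷ 15 ∷ []
  hits x₀ m₂ = 7 ∷ []
  hits x₀ m₃ = 7 ∷ []
  hits x₀ m₄ = 5 ∷ 15 ∷ []
  hits x₀ m₅ = 15 ∷ []
  hits x₀ s₁ = 15 ∷ []
  hits x₀ s₃ = 13 ∷ []
  hits x₀ s₄ = 9 ∷ []
  hits x₁ m₁ = 3 ∷ 9 ∷ 15 ∷ []
  hits x₁ m₂ = 7 ∷ []
  hits x₁ m₃ = 7 ∷ []
  hits x₁ m₄ = 15 ∷ []
  hits x₁ m₅ = 5 ∷ 15 ∷ []
  hits x₁ s₁ = 15 ∷ []
  hits x₁ s₅ = 9 ∷ []
  hits x₁ s₆ = 13 ∷ []
  hits m₁ m₂ = 7 ∷ []
  hits m₁ m₃ = 7 ∷ []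
  hits m₁ m₄ = 15 ∷ []
  hits m₁ m₅ = 15 ∷ []
  hits m₁ s₁ = 3 ∷ 15 ∷ []
  hits m₁ s₂ = 7 ∷ []
  hits m₁ s₇ = 15 ∷ []
  hits m₁ s₈ = 5 ∷ 15 ∷ []
  hits m₂ m₁ = 3 ∷ []
  hits m₂ m₅ = 3 ∷ []
  hits m₃ m₁ = 3 ∷ []
  hits m₃ m₄ = 3 ∷ []
  hits s₁ m₄ = 3 ∷ []
  hits s₁ m₅ = 3 ∷ []
  hits s₂ s₁ = 3 ∷ []
  hits s₂ s₇ = 3 ∷ []
  hits _  _  = []

  occurs : List ℕ → ℕ → ℕ
  occurs []       u = 0
  occurs (g ∷ gs) u = if u ≡ᵇ g then 1 else occurs gs u

  -- Only x, x + 1 and M₁ divide some 1 + poly i.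
  component : Prime → Maybe (ℕ × ℕ × ℕ → ℕ)
  component x₀ = just proj₁
  component x₁ = just (proj₁ ∘ proj₂)
  component m₁ = just (proj₂ ∘ proj₂)
  component _  = nothing

  -- The multiplicity of poly j in 1 + poly i.
  base : Prime → Prime → ℕ
  base i j = maybe′ (λ f → f (shape i)) 0 (component j)

  -- Splitting h + 1 into a power of two and an odd part

  even-or-odd : ∀ m → (∃ λ k → m ≡ k + k) ⊎ (∃ λ k → m ≡ suc (k + k))
  even-or-odd zero = inj₁ (0 , refl)
  even-or-odd (suc m) with even-or-odd m
  ... | inj₁ (k , refl) = inj₂ (k , refl)
  ... | inj₂ (k , refl) = inj₁ (suc k , cong suc (sym (ℕₚ.+-suc k k)))

  Oddℕ : ℕ → Set
  Oddℕ u = ¬ 2 ∣ℕ u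

  -- The first argument is fuel. Each step halves m, so m ≤ n is enough; the clause for exhausted
  -- fuel is then never reached with m > 0.
  split : ℕ → ℕ → ℕ × ℕ
  split zero    m = 0 , m
  split (suc n) m = if m % 2 ≡ᵇ 0 then map₁ suc (split n (m / 2)) else (0 , m)

  split-correct : ∀ n m → 0 < m → m ≤ n →
    m ≡ 2 ^ proj₁ (split n m) * proj₂ (split n m) × Oddℕ (proj₂ (split n m))
  split-correct zero    m 0<m m≤n = ⊥-elim (ℕₚ.<⇒≱ 0<m m≤n)
  split-correct (suc n) m 0<m m≤n = go (m % 2) (m%n<n m 2) (m≡m%n+[m/n]*n m 2)
    where
    Correct : ℕ × ℕ → Set
    Correct (k , u) = m ≡ 2 ^ k * u × Oddℕ u
    go : ∀ r → r < 2 → m ≡ r + m / 2 * 2 → Correct (if r ≡ᵇ 0 then map₁ suc (split n (m / 2)) else (0 , m))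
    go 0 _ e =
        trans (trans e (ℕₚ.*-comm (m / 2) 2)) (trans (cong (2 *_) (proj₁ IH)) (sym (ℕₚ.*-assoc 2 (2 ^ proj₁ (split n (m / 2))) _))) , proj₂ IH
      where
      0<h : 0 < m / 2
      0<h = ℕₚ.n≢0⇒n>0 λ z → ℕₚ.<⇒≢ 0<m (sym (trans e (cong (ℕ._* 2) z)))
      h≤n : m / 2 ≤ n
      h≤n = ℕₚ.≤-pred (ℕₚ.≤-trans (ℕₚ.m<m*n (m / 2) 2 {{ℕ.>-nonZero 0<h}} (s≤s (s≤s z≤n)))
        (ℕₚ.≤-trans (ℕₚ.≤-reflexive (sym e)) m≤n))
      IH = split-correct n (m / 2) 0<h h≤n
    go 1 _ e = sym (ℕₚ.*-identityˡ m) , λ d → ℕ∣.>⇒∤ (s≤s (s≤s z≤n))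
      (ℕ∣.∣m+n∣m⇒∣n (subst (2 ∣ℕ_) (trans e (ℕₚ.+-comm 1 (m / 2 * 2))) d) (divides (m / 2) refl))
    go (suc (suc r)) (s≤s (s≤s ())) e

  -- The exponent h of a prime P determines ν and u with h + 1 = 2^ν u, and then
  -- σ(Pʰ) = (1 + P)^(2^ν - 1) σ(P^(u-1))^(2^ν).
  ν oddPart : ℕ → ℕ
  ν       h = proj₁ (split (suc h) (suc h))
  oddPart h = proj₂ (split (suc h) (suc h))

  suc≡2^ν*oddPart : ∀ h → suc h ≡ 2 ^ ν h * oddPart h
  suc≡2^ν*oddPart h = proj₁ (split-correct (suc h) (suc h) (s≤s z≤n) ℕₚ.≤-refl)

  oddPart-odd : ∀ h → Oddℕ (oddPart h)
  oddPart-odd h = proj₂ (split-correct (suc h) (suc h) (s≤s z≤n) ℕₚ.≤-refl)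

  2^ν : ℕ → ℕ
  2^ν h = 2 ^ ν h

  -- The multiplicity of poly j in σ(poly i ^ h).
  contribution : Prime → Prime → ℕ → ℕ
  contribution i j h = base i j * (2^ν h ∸ 1) + occurs (hits i j) (oddPart h) * 2^ν h

  sigmaExponent : (Prime → ℕ) → Prime → ℕ
  sigmaExponent h j = sumOver primes (λ i → contribution i j (h i))

  record Balanced (h : Prime → ℕ) : Set where
    field
      oddPart-good : ∀ i → oddPart (h i) ∈ good i
      balance      : ∀ j → h j ≡ sigmaExponent h j

  -- Counting binary ones

  -- Bits k m: the binary expansion of m has at most k ones.
  data Bits : ℕ → ℕ → Set where
    0ᵇ    : ∀ {k} → Bits k 0
    evenᵇ : ∀ {k m} → Bits k m → Bits k (m + m)
    oddᵇ  : ∀ {k m} → Bits k m → Bits (suc k) (suc (m + m))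

  Bits-suc : ∀ {k m} → Bits k m → Bits (suc k) m
  Bits-suc 0ᵇ        = 0ᵇ
  Bits-suc (evenᵇ b) = evenᵇ (Bits-suc b)
  Bits-suc (oddᵇ b)  = oddᵇ (Bits-suc b)

  2^suc : ∀ n → 2 ^ suc n ≡ 2 ^ n + 2 ^ n
  2^suc n = cong (2 ^ n +_) (ℕₚ.+-identityʳ (2 ^ n))

  double-+ : ∀ m n → (m + n) + (m + n) ≡ (m + m) + (n + n)
  double-+ m n = interchange m n m n

  -- Adding to a digit 1 clears that digit before carrying one place up, so a carry never increases
  -- the number of ones.
  Bits-+2^ : ∀ {k m} → Bits k m → ∀ n → Bits (suc k) (2 ^ n + m)
  Bits-+2^ 0ᵇ zero    = oddᵇ 0ᵇ
  Bits-+2^ 0ᵇ (suc n) = subst (Bits _) (trans (cong (_+ (2 ^ n + 0)) (ℕₚ.+-identityʳ (2 ^ n))) (sym (ℕₚ.+-identityʳ (2 ^ suc n))))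
    (evenᵇ (Bits-+2^ 0ᵇ n))
  Bits-+2^ (evenᵇ b) zero    = oddᵇ b
  Bits-+2^ (evenᵇ {m = m} b) (suc n) = subst (Bits _)
    (trans (double-+ (2 ^ n) m) (cong (_+ (m + m)) (sym (2^suc n)))) (evenᵇ (Bits-+2^ b n))
  Bits-+2^ (oddᵇ {m = m} b) zero    = subst (Bits _) (cong suc (ℕₚ.+-suc m m)) (evenᵇ (Bits-suc (Bits-+2^ b zero)))
  Bits-+2^ (oddᵇ {m = m} b) (suc n) = subst (Bits _)
    (trans (cong suc (trans (double-+ (2 ^ n) m) (cong (_+ (m + m)) (sym (2^suc n))))) (sym (ℕₚ.+-suc (2 ^ suc n) (m + m))))
    (oddᵇ (Bits-+2^ b n))

  even≢odd : ∀ m n → m + m ≢ suc (n + n)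
  even≢odd (suc m) (suc n) e = even≢odd m n (ℕₚ.suc-injective (ℕₚ.suc-injective
    (trans (cong suc (sym (ℕₚ.+-suc m m))) (trans e (cong (suc ∘ suc) (ℕₚ.+-suc n n))))))
  even≢odd (suc m) zero    e with () ← trans (sym (ℕₚ.+-suc m m)) (ℕₚ.suc-injective e)

  double-injective : ∀ m n → m + m ≡ n + n → m ≡ n
  double-injective zero    zero    e = refl
  double-injective (suc m) (suc n) e = cong suc (double-injective m n (ℕₚ.suc-injective
    (trans (sym (ℕₚ.+-suc m m)) (trans (ℕₚ.suc-injective e) (ℕₚ.+-suc n n)))))

  2^suc-* : ∀ n u → 2 ^ suc n * u ≡ 2 ^ n * u + 2 ^ n * u
  2^suc-* n u = trans (cong (_* u) (2^suc n)) (ℕₚ.*-distribʳ-+ u (2 ^ n) (2 ^ n))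

  -- 2ⁿu - 1 ends in n ones.
  Bits-bound : ∀ {k m} → Bits k m → ∀ n u → suc m ≡ 2 ^ n * u → n ≤ k
  Bits-bound b          zero    u e = z≤n
  Bits-bound 0ᵇ       (suc n) u e = ⊥-elim (even≢odd (2 ^ n * u) 0 (sym (trans e (2^suc-* n u))))
  Bits-bound (evenᵇ {m = m} b) (suc n) u e = ⊥-elim (even≢odd (2 ^ n * u) m (sym (trans e (2^suc-* n u))))
  Bits-bound (oddᵇ {m = m} b) (suc n) u e = s≤s (Bits-bound b n u (double-injective (suc m) (2 ^ n * u)
    (trans (cong suc (ℕₚ.+-suc m m)) (trans e (2^suc-* n u)))))

  -- Used for the exponent of M₁, where a bound on the size of the summands from `outer` becomes a
  -- bound on the ones of their sum.
  <2^⇒Bits : ∀ k m → m < 2 ^ k → Bits k m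
  <2^⇒Bits zero    zero    _  = 0ᵇ
  <2^⇒Bits zero    (suc m) (s≤s ())
  <2^⇒Bits (suc k) m       lt with even-or-odd m
  ... | inj₁ (j , refl) = Bits-suc (evenᵇ (<2^⇒Bits k j (half (subst (j + j <_) (2^suc k) lt))))
    where
    half : ∀ {n} → j + j < n + n → j < n
    half lt = ℕₚ.≰⇒> λ le → ℕₚ.<⇒≱ lt (ℕₚ.+-mono-≤ le le)
  ... | inj₂ (j , refl) = oddᵇ (<2^⇒Bits k j (half (subst (suc (j + j) <_) (2^suc k) lt)))
    where
    half : ∀ {n} → suc (j + j) < n + n → j < n
    half lt = ℕₚ.≰⇒> λ le → ℕₚ.<⇒≱ lt (ℕₚ.m≤n⇒m≤1+n (ℕₚ.+-mono-≤ le le))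

  -- Bounds on the exponents ν

  nonempty : List ℕ → ℕ
  nonempty []      = 0
  nonempty (_ ∷ _) = 1

  hit : Prime → Prime → ℕ → ℕ
  hit i j h = occurs (hits i j) (oddPart h) * 2^ν h

  occurs-0or1 : ∀ gs u → occurs gs u ≡ 0 ⊎ occurs gs u ≡ 1
  occurs-0or1 []       u = inj₁ refl
  occurs-0or1 (g ∷ gs) u with u ≡ᵇ g
  ... | true  = inj₂ refl
  ... | false = occurs-0or1 gs u

  -- Multiplicities in the tables are 0 or 1, so each prime adds either nothing or a single power of
  -- two; an empty table leaves the count unchanged.
  Bits-hit : ∀ {k m} → Bits k m → ∀ i j h → Bits (nonempty (hits i j) + k) (hit i j h + m)
  Bits-hit b i j h with hits i j
  ... | []     = b
  ... | g ∷ gs with occurs-0or1 (g ∷ gs) (oddPart h)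
  ...   | inj₁ z rewrite z = Bits-suc b
  ...   | inj₂ o rewrite o = subst (λ t → Bits _ (t + _)) (sym (ℕₚ.*-identityˡ (2^ν h))) (Bits-+2^ b (ν h))

  hit≤ : ∀ i j h → hit i j h ≤ nonempty (hits i j) * 2^ν h
  hit≤ i j h with hits i j
  ... | []     = z≤n
  ... | g ∷ gs with occurs-0or1 (g ∷ gs) (oddPart h)
  ...   | inj₁ z rewrite z = z≤n
  ...   | inj₂ o rewrite o = ℕₚ.≤-refl

  -- The primes that divide no 1 + P. Their exponents lack the terms `base i j * (2^ν h ∸ 1)`, which
  -- have many binary ones.
  Inner : Prime → Set
  Inner j = T (is-nothing (component j))

  base-inner : ∀ i j → Inner j → base i j ≡ 0
  base-inner i j inner with nothing ← component j = refl

  weight : List Prime → Prime → ℕ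
  weight is j = sumOver is (λ i → nonempty (hits i j))

  Bits-contributions : ∀ is j → Inner j → (h : Prime → ℕ) → Bits (weight is j) (sumOver is (λ i → contribution i j (h i)))
  Bits-contributions []       j inner h = 0ᵇ
  Bits-contributions (i ∷ is) j inner h rewrite base-inner i j inner =
    Bits-hit (Bits-contributions is j inner h) i j (h i)

  sumOver-mono : ∀ is {f g} → (∀ {i} → i ∈ is → f i ≤ g i) → sumOver is f ≤ sumOver is g
  sumOver-mono []       le = z≤n
  sumOver-mono (i ∷ is) le = ℕₚ.+-mono-≤ (le (here refl)) (sumOver-mono is (le ∘ there))

  ≤-sumOver : ∀ {is i} → i ∈ is → ∀ f → f i ≤ sumOver is f
  ≤-sumOver {i ∷ is} (here refl) f = ℕₚ.m≤m+n (f i) _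
  ≤-sumOver {i ∷ is} (there i∈)  f = ℕₚ.≤-trans (≤-sumOver i∈ f) (ℕₚ.m≤n+m _ (f i))

  outer : List Prime
  outer = drop 3 primes

  outer-inner : All Inner outer
  outer-inner = toWitness {a? = all? (λ j → T? (is-nothing (component j))) outer} _

  -- Bounds the contribution of i ∈ outer to the exponent of M₁, since ν ≤ weight there.
  tailBound : Prime → ℕ
  tailBound i = base i m₁ * (2 ^ weight primes i ∸ 1) + nonempty (hits i m₁) * 2 ^ weight primes i

  weight≤8 : All (λ j → weight primes j ≤ 8) outer
  weight≤8 = toWitness {a? = all? (λ j → weight primes j ℕ.≤? 8) outer} _

  sum-tailBound : sumOver outer tailBound < 2 ^ 6
  sum-tailBound = toWitness {a? = sumOver outer tailBound ℕ.<? 2 ^ 6} _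

  good≤15 : ∀ i → All (λ u → u ≤ 15) (good i)
  good≤15 = for-primes (toWitness {a? = all? (λ i → all? (ℕ._≤? 15) (good i)) primes} _)

  m₁∷outer : List Prime
  m₁∷outer = m₁ ∷ outer

  -- A nontrivial odd part for x leaves a trace in a prime other than x and x + 1, so its power of
  -- two shows up in an exponent that is already bounded.
  x₀-hits : All (λ u → u ≡ 1 ⊎ Any (λ j → occurs (hits x₀ j) u ≡ 1) m₁∷outer) (good x₀)
  x₀-hits = toWitness {a? = all? (λ u → (u ℕ.≟ 1) ⊎-dec any? (λ j → occurs (hits x₀ j) u ℕ.≟ 1) m₁∷outer) (good x₀)} _

  x₁-hits : All (λ u → u ≡ 1 ⊎ Any (λ j → occurs (hits x₁ j) u ≡ 1) m₁∷outer) (good x₁)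
  x₁-hits = toWitness {a? = all? (λ u → (u ℕ.≟ 1) ⊎-dec any? (λ j → occurs (hits x₁ j) u ℕ.≟ 1) m₁∷outer) (good x₁)} _

  module _ {h : Prime → ℕ} (bal : Balanced h) where
    open Balanced bal

    ν-inner : ∀ j → Inner j → ν (h j) ≤ weight primes j
    ν-inner j inner = Bits-bound
      (subst (Bits (weight primes j)) (sym (balance j)) (Bits-contributions primes j inner h))
      (ν (h j)) (oddPart (h j)) (suc≡2^ν*oddPart (h j))

    tail≤ : ∀ {i} → i ∈ outer → contribution i m₁ (h i) ≤ tailBound i
    tail≤ {i} i∈ = ℕₚ.+-mono-≤
      (ℕₚ.*-monoʳ-≤ (base i m₁) (ℕₚ.∸-monoˡ-≤ 1 2^ν≤))
      (ℕₚ.≤-trans (hit≤ i m₁ (h i)) (ℕₚ.*-monoʳ-≤ (nonempty (hits i m₁)) 2^ν≤))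
      where
      2^ν≤ : 2^ν (h i) ≤ 2 ^ weight primes i
      2^ν≤ = ℕₚ.^-monoʳ-≤ 2 (ν-inner i (All.lookup outer-inner i∈))

    -- The outer primes contribute less than 2^6, hence at most six ones; M₁ itself contributes
    -- nothing; x and x + 1 add at most one power of two each. This makes eight ones.
    ν-m₁ : ν (h m₁) ≤ 8
    ν-m₁ = Bits-bound (subst (Bits 8) (sym (balance m₁))
        (Bits-hit (Bits-hit (<2^⇒Bits 6 _ (ℕₚ.≤-<-trans (sumOver-mono outer tail≤) sum-tailBound)) x₁ m₁ (h x₁)) x₀ m₁ (h x₀)))
      (ν (h m₁)) (oddPart (h m₁)) (suc≡2^ν*oddPart (h m₁))

    ν≤8 : ∀ {j} → j ∈ m₁∷outer → ν (h j) ≤ 8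
    ν≤8 (here refl) = ν-m₁
    ν≤8 (there j∈)  = ℕₚ.≤-trans (ν-inner _ (All.lookup outer-inner j∈)) (All.lookup weight≤8 j∈)

    -- Every good odd part is at most 15 < 2^4, so h + 1 = 2^ν u < 2^(ν + 4).
    ≤⇒ν≤ : ∀ {n k} j → 2 ^ n ≤ suc (h j) → ν (h j) ≤ k → n ≤ 3 + k
    ≤⇒ν≤ {n} {k} j le ν≤k = ℕₚ.≮⇒≥ λ lt → ℕₚ.<-irrefl refl (begin-strict
      2 ^ (4 + k)                ≤⟨ ℕₚ.^-monoʳ-≤ 2 lt ⟩
      2 ^ n                      ≤⟨ le ⟩
      suc (h j)                  ≡⟨ suc≡2^ν*oddPart (h j) ⟩
      2^ν (h j) * oddPart (h j)  ≤⟨ ℕₚ.*-mono-≤ (ℕₚ.^-monoʳ-≤ 2 ν≤k) (All.lookup (good≤15 j) (oddPart-good j)) ⟩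
      2 ^ k * 15                 <⟨ ℕₚ.*-monoʳ-< (2 ^ k) {{ℕₚ.m^n≢0 2 k}} (ℕₚ.n<1+n 15) ⟩
      2 ^ k * 2 ^ 4              ≡⟨ sym (ℕₚ.^-distribˡ-+-* 2 k 4) ⟩
      2 ^ (k + 4)                ≡⟨ cong (2 ^_) (ℕₚ.+-comm k 4) ⟩
      2 ^ (4 + k)                ∎)
      where open ℕₚ.≤-Reasoning

    contribution≤ : ∀ i j → contribution i j (h i) ≤ h j
    contribution≤ i j = subst (contribution i j (h i) ≤_) (sym (balance j)) (≤-sumOver (∈-primes i) (λ i → contribution i j (h i)))

    -- A hit puts 2^ν into the exponent of j, whose own ν is at most 8; 11 = 3 + 8.
    hit≡1⇒ν≤11 : ∀ i j → j ∈ m₁∷outer → occurs (hits i j) (oddPart (h i)) ≡ 1 → ν (h i) ≤ 11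
    hit≡1⇒ν≤11 i j j∈ o = ≤⇒ν≤ j (ℕₚ.m≤n⇒m≤1+n (ℕₚ.≤-trans 2^ν≤ (contribution≤ i j))) (ν≤8 j∈)
      where
      2^ν≤ : 2^ν (h i) ≤ contribution i j (h i)
      2^ν≤ = subst (2^ν (h i) ≤_) (cong (λ t → base i j * (2^ν (h i) ∸ 1) + t * 2^ν (h i)) (sym o))
        (ℕₚ.≤-trans (ℕₚ.≤-reflexive (sym (ℕₚ.*-identityˡ (2^ν (h i))))) (ℕₚ.m≤n+m _ (base i j * (2^ν (h i) ∸ 1))))

    ν-x : ∀ i → All (λ u → u ≡ 1 ⊎ Any (λ j → occurs (hits i j) u ≡ 1) m₁∷outer) (good i) →
      oddPart (h i) ≡ 1 ⊎ ν (h i) ≤ 11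
    ν-x i hs with All.lookup hs (oddPart-good i)
    ... | inj₁ u≡1  = inj₁ u≡1
    ... | inj₂ some with j , j∈ , o ← find some = inj₂ (hit≡1⇒ν≤11 i j j∈ o)

    base≡1⇒ν≤ : ∀ i j {k} → base i j ≡ 1 → ν (h j) ≤ k → ν (h i) ≤ 3 + k
    base≡1⇒ν≤ i j b ν≤k = ≤⇒ν≤ j (begin
      2^ν (h i)                    ≡⟨ sym (ℕₚ.m+[n∸m]≡n (ℕₚ.m^n>0 2 (ν (h i)))) ⟩
      suc (2^ν (h i) ∸ 1)          ≤⟨ s≤s (ℕₚ.≤-trans (ℕₚ.≤-reflexive (sym (trans (cong (_* (2^ν (h i) ∸ 1)) b) (ℕₚ.*-identityˡ _)))) (ℕₚ.m≤m+n _ _)) ⟩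
      suc (contribution i j (h i)) ≤⟨ s≤s (contribution≤ i j) ⟩
      suc (h j)                    ∎) ν≤k
      where open ℕₚ.≤-Reasoning

    -- One nontrivial odd part suffices: since x + 1 = 1 + x, the 2^ν - 1 of either prime enters the
    -- exponent of the other, which costs 3 more: 14 = 11 + 3.
    ν-bounds : oddPart (h x₀) ≡ 1 × oddPart (h x₁) ≡ 1 ⊎ ν (h x₀) ≤ 14 × ν (h x₁) ≤ 14
    ν-bounds with ν-x x₀ x₀-hits | ν-x x₁ x₁-hits
    ... | inj₁ u₀ | inj₁ u₁ = inj₁ (u₀ , u₁)
    ... | inj₂ ν₀ | _       = inj₂ (ℕₚ.≤-trans ν₀ (ℕₚ.m≤n+m 11 3) , base≡1⇒ν≤ x₁ x₀ refl ν₀)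
    ... | inj₁ _  | inj₂ ν₁ = inj₂ (base≡1⇒ν≤ x₀ x₁ refl ν₁ , ℕₚ.≤-trans ν₁ (ℕₚ.m≤n+m 11 3))

  -- Reduction to three exponents and the finite search

  -- The balance equations determine every exponent from those of x, x + 1 and M₁.
  exponentM₂₃ : ℕ → ℕ → ℕ → ℕ
  exponentM₂₃ a b c = hit x₀ m₂ a + (hit x₁ m₂ b + (hit m₁ m₂ c + 0))

  exponentS₂ : ℕ → ℕ
  exponentS₂ c = hit m₁ s₂ c + 0

  exponentS₁ : ℕ → ℕ → ℕ → ℕ
  exponentS₁ a b c = hit x₀ s₁ a + (hit x₁ s₁ b + (hit m₁ s₁ c + (hit s₂ s₁ (exponentS₂ c) + 0)))

  -- The clauses copy what `sumOver` reduces to, trailing `+ 0` included, so most follow from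
  -- `balance` alone. Dependencies run from x, x + 1, M₁ to M₂, M₃, S₂, then S₁, then M₄, M₅; the
  -- default clause covers the primes that no table hits.
  exponents : ℕ → ℕ → ℕ → Prime → ℕ
  exponents a b c x₀ = a
  exponents a b c x₁ = b
  exponents a b c m₁ = c
  exponents a b c m₂ = exponentM₂₃ a b c
  exponents a b c m₃ = exponentM₂₃ a b c
  exponents a b c m₄ = hit x₀ m₄ a + (hit x₁ m₄ b + (hit m₁ m₄ c +
    (hit m₃ m₄ (exponentM₂₃ a b c) + (hit s₁ m₄ (exponentS₁ a b c) + 0))))
  exponents a b c m₅ = hit x₀ m₅ a + (hit x₁ m₅ b + (hit m₁ m₅ c +
    (hit m₂ m₅ (exponentM₂₃ a b c) + (hit s₁ m₅ (exponentS₁ a b c) + 0))))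
  exponents a b c s₁ = exponentS₁ a b c
  exponents a b c s₂ = exponentS₂ c
  exponents a b c s₃ = hit x₀ s₃ a + 0
  exponents a b c s₄ = hit x₀ s₄ a + 0
  exponents a b c s₅ = hit x₁ s₅ b + 0
  exponents a b c s₆ = hit x₁ s₆ b + 0
  exponents a b c s₇ = hit m₁ s₇ c + (hit s₂ s₇ (exponentS₂ c) + 0)
  exponents a b c s₈ = hit m₁ s₈ c + 0
  exponents a b c _  = 0

  balanced⇒exponents : ∀ {h} → Balanced h → ∀ i → h i ≡ exponents (h x₀) (h x₁) (h m₁) i
  balanced⇒exponents {h} bal = go
    where
    open Balanced bal
    eqS₁ : h s₁ ≡ exponentS₁ (h x₀) (h x₁) (h m₁)
    eqS₁ = trans (balance s₁) (cong (λ t → hit x₀ s₁ (h x₀) + (hit x₁ s₁ (h x₁) + (hit m₁ s₁ (h m₁) + (hit s₂ s₁ t + 0)))) (balance s₂))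
    go : ∀ i → h i ≡ exponents (h x₀) (h x₁) (h m₁) i
    go x₀ = refl
    go x₁ = refl
    go m₁ = refl
    go m₂ = balance m₂
    go m₃ = balance m₃
    go m₄ = trans (balance m₄) (cong₂ (λ t u → hit x₀ m₄ (h x₀) + (hit x₁ m₄ (h x₁) + (hit m₁ m₄ (h m₁) + (hit m₃ m₄ t + (hit s₁ m₄ u + 0)))))
      (balance m₃) eqS₁)
    go m₅ = trans (balance m₅) (cong₂ (λ t u → hit x₀ m₅ (h x₀) + (hit x₁ m₅ (h x₁) + (hit m₁ m₅ (h m₁) + (hit m₂ m₅ t + (hit s₁ m₅ u + 0)))))
      (balance m₂) eqS₁)
    go s₁ = eqS₁
    go s₂ = balance s₂
    go s₃ = balance s₃
    go s₄ = balance s₄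
    go s₅ = balance s₅
    go s₆ = balance s₆
    go s₇ = trans (balance s₇) (cong (λ t → hit m₁ s₇ (h m₁) + (hit s₂ s₇ t + 0)) (balance s₂))
    go s₈ = balance s₈
    go m₆  = balance m₆
    go m₇  = balance m₇
    go m₈  = balance m₈
    go m₉  = balance m₉
    go m₁₀ = balance m₁₀
    go m₁₁ = balance m₁₁
    go m₁₂ = balance m₁₂
    go m₁₃ = balance m₁₃
    go s₉  = balance s₉
    go s₁₀ = balance s₁₀
    go s₁₁ = balance s₁₁
    go s₁₂ = balance s₁₂
    go s₁₃ = balance s₁₃
    go s₁₄ = balance s₁₄
    go s₁₅ = balance s₁₅

  infixr 3 _⇒ᵇ_
  _⇒ᵇ_ : Bool → Bool → Bool
  true  ⇒ᵇ q = q
  false ⇒ᵇ q = true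

  modus-ponens : ∀ {p q} → T (p ⇒ᵇ q) → T p → T q
  modus-ponens {true} q _ = q

  goodᵇ : (Prime → ℕ) → Prime → Bool
  goodᵇ f i = any (oddPart (f i) ≡ᵇ_) (good i)

  balancedᵇ : (Prime → ℕ) → Prime → Bool
  balancedᵇ f j = f j ≡ᵇ sigmaExponent f j

  Triple : Set
  Triple = ℕ × ℕ × ℕ

  -- The exponents of x, x + 1 and M₁ in T₁, ..., T₁₁, in this order.
  solutions : List Triple
  solutions =
    (2 , 1 , 1) ∷ (1 , 2 , 1) ∷ (4 , 3 , 0) ∷ (3 , 4 , 0) ∷ (4 , 4 , 0) ∷ (6 , 3 , 0) ∷ (3 , 6 , 0) ∷
    (4 , 6 , 0) ∷ (6 , 4 , 0) ∷ (2 , 1 , 2) ∷ (1 , 2 , 2) ∷ []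

  sameTriple : ℕ → ℕ → ℕ → Triple → Bool
  sameTriple a b c (a′ , b′ , c′) = (a ≡ᵇ a′) ∧ (b ≡ᵇ b′) ∧ (c ≡ᵇ c′)

  remaining basic : List Prime
  remaining = s₂ ∷ s₈ ∷ m₂ ∷ s₁ ∷ s₇ ∷ m₄ ∷ m₅ ∷ []
  basic     = x₀ ∷ x₁ ∷ m₁ ∷ []

  -- The second alternative lets (x(x+1))^(2^n - 1) pass, which lies in the search range for every n
  -- up to 14; `triple∈solutions` excludes it by hypothesis.
  expected : ℕ → ℕ → ℕ → Bool
  expected a b c = any (sameTriple a b c) solutions ∨ (oddPart a ≡ᵇ 1) ∧ (oddPart b ≡ᵇ 1)

  verdict : ℕ → ℕ → ℕ → Bool
  verdict a b c =
    all (goodᵇ (exponents a b c)) remaining ⇒ᵇ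
    all (balancedᵇ (exponents a b c)) basic ⇒ᵇ
    expected a b c

  candidateExponents : ℕ → Prime → List ℕ
  candidateExponents n i = cartesianProductWith (λ u k → 2 ^ k * u ∸ 1) (good i) (upTo n)

  -- Cheap consequences of the balance equations, tested first to keep the search short.
  plausiblePair : ℕ → ℕ → Bool
  plausiblePair a b = ((2^ν b ∸ 1) ℕ.≤ᵇ a) ∧ ((2^ν a ∸ 1) ℕ.≤ᵇ b)

  plausible : ℕ → ℕ → ℕ → Bool
  plausible a b c = (hit x₀ m₁ a + hit x₁ m₁ b ℕ.≤ᵇ c) ∧ ((2^ν b ∸ 1) + (2^ν c ∸ 1) ℕ.≤ᵇ a) ∧ ((2^ν a ∸ 1) + (2^ν c ∸ 1) ℕ.≤ᵇ b)

  -- The exponents of S₃ and S₄ depend on a alone and those of S₅ and S₆ on b alone, so these primes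
  -- are tested before the next loop is entered, with the other arguments set to 0.
  search : List ℕ → List ℕ → List ℕ → Bool
  search as bs cs =
    all (λ a → all (goodᵇ (exponents a 0 0)) (s₃ ∷ s₄ ∷ []) ⇒ᵇ
      all (λ b → plausiblePair a b ⇒ᵇ all (goodᵇ (exponents 0 b 0)) (s₅ ∷ s₆ ∷ []) ⇒ᵇ
        all (λ c → plausible a b c ⇒ᵇ verdict a b c) cs) bs) as


  abstract
    -- 15 and 9 exceed the bounds 14 and 8 on ν by one because `upTo` excludes its end. `abstract`
    -- keeps the evaluation from being repeated where the result is used.
    search-result : search (candidateExponents 15 x₀) (candidateExponents 15 x₁) (candidateExponents 9 m₁) ≡ true
    search-result = refl

  search-sound : ∀ as bs cs → search as bs cs ≡ true → ∀ {a b c} → a ∈ as → b ∈ bs → c ∈ cs →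
    All (T ∘ goodᵇ (exponents a 0 0)) (s₃ ∷ s₄ ∷ []) → T (plausiblePair a b) →
    All (T ∘ goodᵇ (exponents 0 b 0)) (s₅ ∷ s₆ ∷ []) → T (plausible a b c) → T (verdict a b c)
  search-sound as bs cs e {a} {b} {c} a∈ b∈ c∈ ga p gb q =
    modus-ponens (at (λ c → plausible a b c ⇒ᵇ verdict a b c) cs
      (modus-ponens (modus-ponens (at _ bs (modus-ponens (at _ as (Equivalence.from T-≡ e) a∈)
        (all⁻ (goodᵇ (exponents a 0 0)) {xs = s₃ ∷ s₄ ∷ []} ga)) b∈) p) (all⁻ (goodᵇ (exponents 0 b 0)) {xs = s₅ ∷ s₆ ∷ []} gb)) c∈) q
    where
    at : ∀ {A : Set} (p : A → Bool) xs → T (all p xs) → ∀ {x} → x ∈ xs → T (p x)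
    at p xs t x∈ = All.lookup (all⁺ p xs t) x∈

  verdict-sound : ∀ a b c → T (verdict a b c) → (∀ i → T (goodᵇ (exponents a b c) i)) →
    (∀ j → T (balancedᵇ (exponents a b c) j)) → T (expected a b c)
  verdict-sound a b c v g β =
    modus-ponens {all (balancedᵇ (exponents a b c)) basic} {expected a b c}
      (modus-ponens {all (goodᵇ (exponents a b c)) remaining} {all (balancedᵇ (exponents a b c)) basic ⇒ᵇ expected a b c} v
        (all⁻ (goodᵇ (exponents a b c)) (All.universal g remaining)))
      (all⁻ (balancedᵇ (exponents a b c)) (All.universal β basic))

  ∈-candidateExponents : ∀ n i h → oddPart h ∈ good i → ν h < n → h ∈ candidateExponents n i
  ∈-candidateExponents n i h u∈ lt = subst (_∈ candidateExponents n i)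
    (cong (_∸ 1) (sym (suc≡2^ν*oddPart h)))
    (∈-cartesianProductWith⁺ (λ u k → 2 ^ k * u ∸ 1) u∈ (∈-upTo⁺ lt))

  sumOver-cong : ∀ is {f g} → (∀ i → f i ≡ g i) → sumOver is f ≡ sumOver is g
  sumOver-cong []       e = refl
  sumOver-cong (i ∷ is) e = cong₂ _+_ (e i) (sumOver-cong is e)

  m+0+0≡m : ∀ m → m + 0 + 0 ≡ m
  m+0+0≡m m = trans (ℕₚ.+-identityʳ (m + 0)) (ℕₚ.+-identityʳ m)

  module _ {h : Prime → ℕ} (bal : Balanced h) where
    open Balanced bal
    private
      a = h x₀
      b = h x₁
      c = h m₁
      f = exponents a b c

    h≗f : ∀ i → h i ≡ f i
    h≗f = balanced⇒exponents bal

    good-f : ∀ i → T (goodᵇ f i)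
    good-f i = any⁺ (oddPart (f i) ≡ᵇ_) (Any.map (λ e → ℕₚ.≡⇒≡ᵇ _ _ e)
      (subst (λ t → oddPart t ∈ good i) (h≗f i) (oddPart-good i)))

    balanced-f : ∀ j → T (balancedᵇ f j)
    balanced-f j = ℕₚ.≡⇒≡ᵇ _ _ (trans (sym (h≗f j)) (trans (balance j)
      (sumOver-cong primes (λ i → cong (contribution i j) (h≗f i)))))

    triple∈solutions : ¬ (oddPart a ≡ 1 × oddPart b ≡ 1) → ν a ≤ 14 → ν b ≤ 14 →
      (a , b , c) ∈ solutions
    triple∈solutions ¬both νa νb = conclude (verdict-sound a b c
        (search-sound (candidateExponents 15 x₀) (candidateExponents 15 x₁) (candidateExponents 9 m₁) search-result {a} {b} {c}
          (∈-candidateExponents 15 x₀ a (oddPart-good x₀) (s≤s νa))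
          (∈-candidateExponents 15 x₁ b (oddPart-good x₁) (s≤s νb))
          (∈-candidateExponents 9 m₁ c (oddPart-good m₁) (s≤s (ν-m₁ bal)))
          (good-f s₃ ∷ good-f s₄ ∷ []) pair (good-f s₅ ∷ good-f s₆ ∷ []) plaus)
        good-f balanced-f)
      where
      -- The contribution of x to its own exponent reduces to 0, so the balance equation starts with
      -- x + 1 and then M₁, each with base 1 and no hits.
      bx₀ : (2^ν b ∸ 1) + (2^ν c ∸ 1) ≤ a
      bx₀ = subst₂ _≤_ (cong₂ _+_ (m+0+0≡m (2^ν b ∸ 1)) (m+0+0≡m (2^ν c ∸ 1))) (sym (balance x₀))
        (ℕₚ.+-monoʳ-≤ (contribution x₁ x₀ b) (ℕₚ.m≤m+n (contribution m₁ x₀ c) _))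
      bx₁ : (2^ν a ∸ 1) + (2^ν c ∸ 1) ≤ b
      bx₁ = subst₂ _≤_ (cong₂ _+_ (m+0+0≡m (2^ν a ∸ 1)) (m+0+0≡m (2^ν c ∸ 1))) (sym (balance x₁))
        (ℕₚ.+-monoʳ-≤ (contribution x₀ x₁ a) (ℕₚ.m≤m+n (contribution m₁ x₁ c) _))
      bm₁ : hit x₀ m₁ a + hit x₁ m₁ b ≤ c
      bm₁ = subst (hit x₀ m₁ a + hit x₁ m₁ b ≤_) (sym (balance m₁))
        (ℕₚ.+-monoʳ-≤ (hit x₀ m₁ a) (ℕₚ.m≤m+n (hit x₁ m₁ b) _))
      pair : T (plausiblePair a b)
      pair = Equivalence.from (T-∧ {2^ν b ∸ 1 ℕ.≤ᵇ a} {2^ν a ∸ 1 ℕ.≤ᵇ b})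
        ( ℕₚ.≤⇒≤ᵇ (ℕₚ.≤-trans (ℕₚ.m≤m+n (2^ν b ∸ 1) (2^ν c ∸ 1)) bx₀)
        , ℕₚ.≤⇒≤ᵇ (ℕₚ.≤-trans (ℕₚ.m≤m+n (2^ν a ∸ 1) (2^ν c ∸ 1)) bx₁))
      plaus : T (plausible a b c)
      plaus = Equivalence.from T-∧ (ℕₚ.≤⇒≤ᵇ bm₁ , Equivalence.from T-∧ (ℕₚ.≤⇒≤ᵇ bx₀ , ℕₚ.≤⇒≤ᵇ bx₁))
      sameTriple⇒≡ : ∀ t → T (sameTriple a b c t) → (a , b , c) ≡ t
      sameTriple⇒≡ (a′ , b′ , c′) same with ea , same′ ← Equivalence.to (T-∧ {a ≡ᵇ a′}) same
        with eb , ec ← Equivalence.to (T-∧ {b ≡ᵇ b′}) same′ =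
        cong₂ _,_ (ℕₚ.≡ᵇ⇒≡ a a′ ea) (cong₂ _,_ (ℕₚ.≡ᵇ⇒≡ b b′ eb) (ℕₚ.≡ᵇ⇒≡ c c′ ec))
      conclude : T (expected a b c) → (a , b , c) ∈ solutions
      conclude t with Equivalence.to (T-∨ {any (sameTriple a b c) solutions}) t
      ... | inj₁ s = Any.map (sameTriple⇒≡ _) (any⁻ (sameTriple a b c) solutions s)
      ... | inj₂ both with e₁ , e₂ ← Equivalence.to (T-∧ {oddPart a ≡ᵇ 1}) both =
        ⊥-elim (¬both (ℕₚ.≡ᵇ⇒≡ _ 1 e₁ , ℕₚ.≡ᵇ⇒≡ _ 1 e₂))

  -- The case u = 1 for both x and x + 1

  occurs-1 : All (λ i → All (λ j → occurs (hits i j) 1 ≡ 0) primes) primes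
  occurs-1 = toWitness {a? = all? (λ i → all? (λ j → occurs (hits i j) 1 ℕ.≟ 0) primes) primes} _

  hit-1 : ∀ i j h → oddPart h ≡ 1 → hit i j h ≡ 0
  hit-1 i j h u≡1 = cong (_* 2^ν h) (trans (cong (occurs (hits i j)) u≡1) (for-primes (for-primes occurs-1 i) j))

  -- Every Mᵢ and Sᵢ is 1 plus a multiple of x, so a factor 2 in its h + 1 is visible in the
  -- exponent of x.
  base-x₀-pos : All (λ i → 0 < base i x₀) m₁∷outer
  base-x₀-pos = toWitness {a? = all? (λ i → 0 ℕ.<? base i x₀) m₁∷outer} _

  +≡0 : ∀ {m n} → m ≡ 0 → n ≡ 0 → m + n ≡ 0
  +≡0 refl refl = refl

  module _ {h : Prime → ℕ} (bal : Balanced h) (ua : oddPart (h x₀) ≡ 1) (ub : oddPart (h x₁) ≡ 1) where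
    open Balanced bal
    private
      a = h x₀
      b = h x₁
      c = h m₁

    oddPart≡1⇒ : ∀ e → oddPart e ≡ 1 → e ≡ 2^ν e ∸ 1
    oddPart≡1⇒ e u = cong (_∸ 1) (trans (suc≡2^ν*oddPart e) (trans (cong (2^ν e *_) u) (ℕₚ.*-identityʳ (2^ν e))))

    tailSum : Prime → ℕ
    tailSum j = sumOver m₁∷outer (λ i → contribution i j (h i))

    -- For u = 1 the exponent of x + 1 is 2^ν - 1, which is also its contribution to the exponent of
    -- x. With the same for x, each exponent is the other plus a tail, so both tails vanish.
    a≡b+tail : a ≡ b + tailSum x₀
    a≡b+tail = trans (balance x₀) (cong (_+ tailSum x₀) (trans (m+0+0≡m (2^ν b ∸ 1)) (sym (oddPart≡1⇒ b ub))))

    b≡a+tail : b ≡ a + tailSum x₁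
    b≡a+tail = trans (balance x₁) (cong (_+ tailSum x₁) (trans (m+0+0≡m (2^ν a ∸ 1)) (sym (oddPart≡1⇒ a ua))))

    a≡b : a ≡ b
    a≡b = ℕₚ.≤-antisym (subst (a ≤_) (sym b≡a+tail) (ℕₚ.m≤m+n a _)) (subst (b ≤_) (sym a≡b+tail) (ℕₚ.m≤m+n b _))

    tailSum≡0 : tailSum x₀ ≡ 0
    tailSum≡0 = ℕₚ.+-cancelˡ-≡ b _ _ (trans (sym a≡b+tail) (trans a≡b (sym (ℕₚ.+-identityʳ b))))

    ν≡0 : ∀ {i} → i ∈ m₁∷outer → ν (h i) ≡ 0
    ν≡0 {i} i∈ with ℕₚ.m*n≡0⇒m≡0∨n≡0 (base i x₀)
      (ℕₚ.m+n≡0⇒m≡0 _ (ℕₚ.n≤0⇒n≡0 (subst (contribution i x₀ (h i) ≤_) tailSum≡0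
        (≤-sumOver i∈ (λ i → contribution i x₀ (h i))))))
    ... | inj₁ z = ⊥-elim (ℕₚ.<⇒≢ (All.lookup base-x₀-pos i∈) (sym z))
    ... | inj₂ z = 2^n≤1⇒n≡0 (ν (h i)) (ℕₚ.m∸n≡0⇒m≤n z)
      where
      2^n≤1⇒n≡0 : ∀ n → 2 ^ n ≤ 1 → n ≡ 0
      2^n≤1⇒n≡0 zero    _  = refl
      2^n≤1⇒n≡0 (suc n) le = ⊥-elim (ℕₚ.<⇒≱ (ℕₚ.≤-trans (ℕₚ.^-monoʳ-≤ 2 {1} {suc n} (s≤s z≤n)) ℕₚ.≤-refl) le)

    exponent≢1 : ∀ {i} → i ∈ m₁∷outer → h i ≢ 1
    exponent≢1 i∈ e with () ← trans (sym (ν≡0 i∈)) (cong ν e)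

    -- As ν = 0, c + 1 is itself one of 1, 3, 5, 7, 15. The values 3, 5, 7, 15 give exponent 1 to
    -- S₁, S₈, S₂, S₈ respectively, and exponent 1 has ν = 1.
    c≡0 : c ≡ 0
    c≡0 = go (subst (_∈ good m₁) (sym suc-c) (oddPart-good m₁))
      where
      suc-c : suc c ≡ oddPart c
      suc-c = trans (suc≡2^ν*oddPart c) (trans (cong (λ n → 2 ^ n * oddPart c) (ν≡0 (here refl))) (ℕₚ.*-identityˡ _))
      ∈outer : ∀ j → All (λ i → i ≢ j) (x₀ ∷ x₁ ∷ []) → j ∈ m₁∷outer
      ∈outer j (n₀ ∷ n₁ ∷ []) with ∈-primes j
      ... | here e         = ⊥-elim (n₀ (sym e))
      ... | there (here e) = ⊥-elim (n₁ (sym e))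
      ... | there (there m) = m
      s₈≢ : h s₈ ≢ 1
      s₈≢ = exponent≢1 (∈outer s₈ ((λ ()) ∷ (λ ()) ∷ []))
      go : suc c ∈ good m₁ → c ≡ 0
      go (here e) = ℕₚ.suc-injective e
      go (there (here e)) = ⊥-elim (exponent≢1 (∈outer s₁ ((λ ()) ∷ (λ ()) ∷ []))
        (trans (balanced⇒exponents bal s₁) (trans (cong (exponentS₁ a b) (ℕₚ.suc-injective e))
          (cong₂ (λ m n → m + (n + 1)) (hit-1 x₀ s₁ a ua) (hit-1 x₁ s₁ b ub)))))
      go (there (there (here e))) = ⊥-elim (s₈≢ (trans (balance s₈) (cong (λ t → hit m₁ s₈ t + 0) (ℕₚ.suc-injective e))))
      go (there (there (there (here e)))) = ⊥-elim (exponent≢1 (∈outer s₂ ((λ ()) ∷ (λ ()) ∷ []))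
        (trans (balance s₂) (cong exponentS₂ (ℕₚ.suc-injective e))))
      go (there (there (there (there (here e))))) = ⊥-elim (s₈≢ (trans (balance s₈) (cong (λ t → hit m₁ s₈ t + 0) (ℕₚ.suc-injective e))))

    outer≡0 : ∀ {i} → i ∈ m₁∷outer → h i ≡ 0
    outer≡0 {i} i∈ = trans (balanced⇒exponents bal i)
      (trans (cong (λ t → exponents a b t i) c≡0) (All.lookup zeros i∈))
      where
      za = λ j → hit-1 x₀ j a ua
      zb = λ j → hit-1 x₁ j b ub
      zM : exponentM₂₃ a b 0 ≡ 0
      zM = +≡0 (za m₂) (+≡0 (zb m₂) refl)
      zS : exponentS₁ a b 0 ≡ 0
      zS = +≡0 (za s₁) (+≡0 (zb s₁) refl)
      zeros : All (λ i → exponents a b 0 i ≡ 0) m₁∷outer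
      zeros = refl ∷ zM ∷ zM
        ∷ +≡0 (za m₄) (+≡0 (zb m₄) (+≡0 (cong (hit m₃ m₄) zM) (+≡0 (cong (hit s₁ m₄) zS) refl)))
        ∷ +≡0 (za m₅) (+≡0 (zb m₅) (+≡0 (cong (hit m₂ m₅) zM) (+≡0 (cong (hit s₁ m₅) zS) refl)))
        ∷ refl ∷ refl ∷ refl ∷ refl ∷ refl ∷ refl ∷ refl ∷ refl
        ∷ zS ∷ refl
        ∷ +≡0 (za s₃) refl ∷ +≡0 (za s₄) refl ∷ +≡0 (zb s₅) refl ∷ +≡0 (zb s₆) refl
        ∷ refl ∷ refl ∷ refl ∷ refl ∷ refl ∷ refl ∷ refl ∷ refl ∷ refl ∷ []

  -- `splitting` records equality of the two exponents rather than the form 2^n - 1: this is enough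
  -- for `Splits` and for divisibility by x.
  data Solution (h : Prime → ℕ) : Set where
    splitting : h x₀ ≡ h x₁ → (∀ {i} → i ∈ m₁∷outer → h i ≡ 0) → Solution h
    sporadic  : ∀ {a b c} → (a , b , c) ∈ solutions → (∀ i → h i ≡ exponents a b c i) → Solution h

  balanced⇒solution : ∀ {h} → Balanced h → Solution h
  balanced⇒solution {h} bal with oddPart (h x₀) ℕ.≟ 1 | oddPart (h x₁) ℕ.≟ 1 | ν-bounds bal
  ... | yes ua | yes ub | _ = splitting (a≡b bal ua ub) (outer≡0 bal ua ub)
  ... | no  na | _      | inj₁ (ua , _)  = ⊥-elim (na ua)
  ... | _      | no nb  | inj₁ (_ , ub)  = ⊥-elim (nb ub)
  ... | no  na | _      | inj₂ (νa , νb) = sporadic (triple∈solutions bal (na ∘ proj₁) νa νb) (balanced⇒exponents bal)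
  ... | yes _  | no nb  | inj₂ (νa , νb) = sporadic (triple∈solutions bal (nb ∘ proj₂) νa νb) (balanced⇒exponents bal)

open import Defs
open ExponentSystem

-- The ring 𝔽₂[x] and division with remainder

bit : Bool → Poly → Poly
bit false = shift
bit true  = cons1

-- A Horner form that hides the implicit leading coefficient: `one`, `c0 p` and `c1 p` all become
-- `bit b p`, so the ring laws get a uniform induction. Views are not unique, as `bit false 0ₚ` is
-- `0ₚ`, which does no harm.
data View : Poly → Set where
  0ᵛ   : View 0ₚ
  bitᵛ : ∀ b {p} → View p → View (bit b p)

view⁺ : ∀ p → View ⟨ p ⟩
view⁺ one    = bitᵛ true 0ᵛ
view⁺ (c0 p) = bitᵛ false (view⁺ p)
view⁺ (c1 p) = bitᵛ true (view⁺ p)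

view : ∀ p → View p
view 0ₚ    = 0ᵛ
view ⟨ p ⟩ = view⁺ p

+-identityʳ : ∀ p → p + 0ₚ ≡ p
+-identityʳ 0ₚ    = refl
+-identityʳ ⟨ p ⟩ = refl

bit-+ : ∀ b c p q → bit b p + bit c q ≡ bit (b xor c) (p + q)
bit-+ false false 0ₚ    0ₚ    = refl
bit-+ false false 0ₚ    ⟨ q ⟩ = refl
bit-+ false false ⟨ p ⟩ 0ₚ    = refl
bit-+ false false ⟨ p ⟩ ⟨ q ⟩ = refl
bit-+ false true  0ₚ    q     = refl
bit-+ false true  ⟨ p ⟩ 0ₚ    = refl
bit-+ false true  ⟨ p ⟩ ⟨ q ⟩ = refl
bit-+ true  false 0ₚ    0ₚ    = refl
bit-+ true  false 0ₚ    ⟨ q ⟩ = refl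
bit-+ true  false ⟨ p ⟩ 0ₚ    = refl
bit-+ true  false ⟨ p ⟩ ⟨ q ⟩ = refl
bit-+ true  true  0ₚ    0ₚ    = refl
bit-+ true  true  0ₚ    ⟨ q ⟩ = refl
bit-+ true  true  ⟨ p ⟩ 0ₚ    = refl
bit-+ true  true  ⟨ p ⟩ ⟨ q ⟩ = refl

+-comm : ∀ p q → p + q ≡ q + p
+-comm p q = go (view p) (view q)
  where
  go : ∀ {p q} → View p → View q → p + q ≡ q + p
  go {q = q} 0ᵛ u = sym (+-identityʳ q)
  go {p = p} (bitᵛ _ _) 0ᵛ = +-identityʳ p
  go (bitᵛ b {p} u) (bitᵛ c {q} v) =
    trans (bit-+ b c p q) (trans (cong₂ bit (xor-comm b c) (go u v)) (sym (bit-+ c b q p)))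

+-assoc : ∀ p q r → (p + q) + r ≡ p + (q + r)
+-assoc p q r = go (view p) (view q) (view r)
  where
  go : ∀ {p q r} → View p → View q → View r → (p + q) + r ≡ p + (q + r)
  go 0ᵛ u v = refl
  go {p = p} {r = r} (bitᵛ _ _) 0ᵛ v = cong (_+ r) (+-identityʳ p)
  go {p = p} {q = q} (bitᵛ b u) (bitᵛ c v) 0ᵛ =
    trans (+-identityʳ (p + q)) (cong (p +_) (sym (+-identityʳ q)))
  go (bitᵛ a {p} u) (bitᵛ b {q} v) (bitᵛ c {r} w) = begin
    (bit a p + bit b q) + bit c r       ≡⟨ cong (_+ bit c r) (bit-+ a b p q) ⟩
    bit (a xor b) (p + q) + bit c r     ≡⟨ bit-+ (a xor b) c (p + q) r ⟩
    bit ((a xor b) xor c) (p + q + r)   ≡⟨ cong₂ bit (xor-assoc a b c) (go u v w) ⟩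
    bit (a xor (b xor c)) (p + (q + r)) ≡⟨ sym (bit-+ a (b xor c) p (q + r)) ⟩
    bit a p + bit (b xor c) (q + r)     ≡⟨ cong (bit a p +_) (sym (bit-+ b c q r)) ⟩
    bit a p + (bit b q + bit c r)       ∎
    where open ≡-Reasoning

+-self : ∀ p → p + p ≡ 0ₚ
+-self p = go (view p)
  where
  go : ∀ {p} → View p → p + p ≡ 0ₚ
  go 0ᵛ = refl
  go (bitᵛ b {p} u) = trans (bit-+ b b p p) (cong₂ bit (xor-same b) (go u))

+-interchange : ∀ p q r s → (p + q) + (r + s) ≡ (p + r) + (q + s)
+-interchange p q r s = begin
  (p + q) + (r + s) ≡⟨ +-assoc p q (r + s) ⟩
  p + (q + (r + s)) ≡⟨ cong (p +_) (sym (+-assoc q r s)) ⟩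
  p + (q + r + s)   ≡⟨ cong (λ t → p + (t + s)) (+-comm q r) ⟩
  p + (r + q + s)   ≡⟨ cong (p +_) (+-assoc r q s) ⟩
  p + (r + (q + s)) ≡⟨ sym (+-assoc p r (q + s)) ⟩
  (p + r) + (q + s) ∎
  where open ≡-Reasoning

+-cancel-middle : ∀ p q r → (p + q) + (q + r) ≡ p + r
+-cancel-middle p q r = begin
  (p + q) + (q + r) ≡⟨ +-assoc p q (q + r) ⟩
  p + (q + (q + r)) ≡⟨ cong (p +_) (sym (+-assoc q q r)) ⟩
  p + (q + q + r)   ≡⟨ cong (λ t → p + (t + r)) (+-self q) ⟩
  p + r             ∎
  where open ≡-Reasoning

+≡0⇒≡ : ∀ p q → p + q ≡ 0ₚ → p ≡ q
+≡0⇒≡ p q e = begin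
  p             ≡⟨ sym (+-identityʳ p) ⟩
  p + 0ₚ        ≡⟨ cong (p +_) (sym (+-self q)) ⟩
  p + (q + q)   ≡⟨ sym (+-assoc p q q) ⟩
  (p + q) + q   ≡⟨ cong (_+ q) e ⟩
  q             ∎
  where open ≡-Reasoning

shift-+ : ∀ p q → shift (p + q) ≡ shift p + shift q
shift-+ p q = sym (bit-+ false false p q)

cons1-shift : ∀ p → cons1 p ≡ 1ₚ + shift p
cons1-shift 0ₚ    = refl
cons1-shift ⟨ p ⟩ = refl

bit-* : ∀ b p q → bit b p * q ≡ (if b then q else 0ₚ) + shift (p * q)
bit-* false 0ₚ    q = refl
bit-* false ⟨ p ⟩ q = refl
bit-* true  0ₚ    q = sym (+-identityʳ q)
bit-* true  ⟨ p ⟩ q = refl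

*-zeroʳ : ∀ p → p * 0ₚ ≡ 0ₚ
*-zeroʳ p = go (view p)
  where
  go : ∀ {p} → View p → p * 0ₚ ≡ 0ₚ
  go 0ᵛ = refl
  go (bitᵛ false {p} u) = trans (bit-* false p 0ₚ) (cong shift (go u))
  go (bitᵛ true {p} u)  = trans (bit-* true p 0ₚ) (cong shift (go u))

*-distribˡ-+ : ∀ p q r → p * (q + r) ≡ p * q + p * r
*-distribˡ-+ p q r = go (view p)
  where
  open ≡-Reasoning
  pick-+ : ∀ b → (if b then q + r else 0ₚ) ≡ (if b then q else 0ₚ) + (if b then r else 0ₚ)
  pick-+ false = refl
  pick-+ true  = refl
  go : ∀ {p} → View p → p * (q + r) ≡ p * q + p * r
  go 0ᵛ = refl
  go (bitᵛ b {p} u) = begin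
    bit b p * (q + r)
      ≡⟨ bit-* b p (q + r) ⟩
    (if b then q + r else 0ₚ) + shift (p * (q + r))
      ≡⟨ cong₂ _+_ (pick-+ b) (trans (cong shift (go u)) (shift-+ (p * q) (p * r))) ⟩
    ((if b then q else 0ₚ) + (if b then r else 0ₚ)) + (shift (p * q) + shift (p * r))
      ≡⟨ +-interchange (if b then q else 0ₚ) (if b then r else 0ₚ) _ _ ⟩
    ((if b then q else 0ₚ) + shift (p * q)) + ((if b then r else 0ₚ) + shift (p * r))
      ≡⟨ cong₂ _+_ (sym (bit-* b p q)) (sym (bit-* b p r)) ⟩
    bit b p * q + bit b p * r ∎

*-shiftʳ : ∀ p q → p * shift q ≡ shift (p * q)
*-shiftʳ p q = go (view p)
  where
  go : ∀ {p} → View p → p * shift q ≡ shift (p * q)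
  go 0ᵛ = refl
  go (bitᵛ false {p} u) = trans (bit-* false p (shift q))
    (cong shift (trans (go u) (sym (bit-* false p q))))
  go (bitᵛ true {p} u) = trans (bit-* true p (shift q))
    (trans (cong (λ t → shift q + shift t) (go u))
      (trans (sym (shift-+ q (shift (p * q)))) (cong shift (sym (bit-* true p q)))))

*-identityʳ : ∀ p → p * 1ₚ ≡ p
*-identityʳ p = go (view p)
  where
  go : ∀ {p} → View p → p * 1ₚ ≡ p
  go 0ᵛ = refl
  go (bitᵛ false {p} u) = trans (bit-* false p 1ₚ) (cong shift (go u))
  go (bitᵛ true {p} u)  = trans (bit-* true p 1ₚ)
    (trans (cong (λ t → 1ₚ + shift t) (go u)) (sym (cons1-shift p)))

*-bitʳ : ∀ b p q → p * bit b q ≡ (if b then p else 0ₚ) + shift (p * q)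
*-bitʳ false p q = *-shiftʳ p q
*-bitʳ true  p q = begin
  p * cons1 q             ≡⟨ cong (p *_) (cons1-shift q) ⟩
  p * (1ₚ + shift q)      ≡⟨ *-distribˡ-+ p 1ₚ (shift q) ⟩
  p * 1ₚ + p * shift q    ≡⟨ cong₂ _+_ (*-identityʳ p) (*-shiftʳ p q) ⟩
  p + shift (p * q)       ∎
  where open ≡-Reasoning

*-comm : ∀ p q → p * q ≡ q * p
*-comm p q = go (view p)
  where
  go : ∀ {p} → View p → p * q ≡ q * p
  go 0ᵛ = sym (*-zeroʳ q)
  go (bitᵛ b {p} u) = trans (bit-* b p q)
    (trans (cong (λ t → (if b then q else 0ₚ) + shift t) (go u)) (sym (*-bitʳ b q p)))

*-distribʳ-+ : ∀ r p q → (p + q) * r ≡ p * r + q * r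
*-distribʳ-+ r p q = trans (*-comm (p + q) r)
  (trans (*-distribˡ-+ r p q) (cong₂ _+_ (*-comm r p) (*-comm r q)))

*-assoc : ∀ p q r → (p * q) * r ≡ p * (q * r)
*-assoc p q r = go (view p)
  where
  open ≡-Reasoning
  pick-* : ∀ b → (if b then q else 0ₚ) * r ≡ (if b then q * r else 0ₚ)
  pick-* false = refl
  pick-* true  = refl
  go : ∀ {p} → View p → (p * q) * r ≡ p * (q * r)
  go 0ᵛ = refl
  go (bitᵛ b {p} u) = begin
    (bit b p * q) * r
      ≡⟨ cong (_* r) (bit-* b p q) ⟩
    ((if b then q else 0ₚ) + shift (p * q)) * r
      ≡⟨ *-distribʳ-+ r (if b then q else 0ₚ) (shift (p * q)) ⟩
    (if b then q else 0ₚ) * r + shift (p * q) * r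
      ≡⟨ cong₂ _+_ (pick-* b) (trans (bit-* false (p * q) r) (cong shift (go u))) ⟩
    (if b then q * r else 0ₚ) + shift (p * (q * r))
      ≡⟨ sym (bit-* b p (q * r)) ⟩
    bit b p * (q * r) ∎

𝔽₂[x] : CommutativeRing _ _
𝔽₂[x] = record
  { Carrier = Poly ; _≈_ = _≡_ ; _+_ = _+_ ; _*_ = _*_ ; -_ = λ p → p ; 0# = 0ₚ ; 1# = 1ₚ
  ; isCommutativeRing = record
    { isRing = record
      { +-isAbelianGroup = record
        { isGroup = record
          { isMonoid = record
            { isSemigroup = record
              { isMagma = record { isEquivalence = isEquivalence ; ∙-cong = cong₂ _+_ }
              ; assoc = +-assoc }
            ; identity = (λ _ → refl) , +-identityʳ }
          ; inverse = +-self , +-self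
          ; ⁻¹-cong = λ e → e }
        ; comm = +-comm }
      ; *-cong = cong₂ _*_
      ; *-assoc = *-assoc
      ; *-identity = (λ _ → refl) , *-identityʳ
      ; distrib = *-distribˡ-+ , *-distribʳ-+ }
    ; *-comm = *-comm } }

open CommutativeSemigroupₚ
  (CommutativeRing.*-commutativeSemigroup 𝔽₂[x])
  using () renaming (interchange to *-interchange; x∙yz≈y∙xz to *-swapˡ)

deg⁺ : P⁺ → ℕ
deg⁺ one    = 0
deg⁺ (c0 p) = suc (deg⁺ p)
deg⁺ (c1 p) = suc (deg⁺ p)

-- The number of coefficients, so that 0ₚ is smaller than every constant.
size : Poly → ℕ
size 0ₚ    = 0
size ⟨ p ⟩ = suc (deg⁺ p)

size-bit : ∀ b {p n} → size p ≡ suc n → size (bit b p) ≡ suc (suc n)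
size-bit false {⟨ p ⟩} e = cong suc e
size-bit true  {⟨ p ⟩} e = cong suc e

size-bit-≤ : ∀ b p → size (bit b p) ≤ suc (size p)
size-bit-≤ false 0ₚ    = z≤n
size-bit-≤ false ⟨ p ⟩ = ℕₚ.≤-refl
size-bit-≤ true  0ₚ    = ℕₚ.≤-refl
size-bit-≤ true  ⟨ p ⟩ = ℕₚ.≤-refl

size-add⁺-< : ∀ p q → deg⁺ p < deg⁺ q → size (add⁺ p q) ≡ suc (deg⁺ q)
size-add⁺-< one    (c0 q) _        = refl
size-add⁺-< one    (c1 q) _        = refl
size-add⁺-< (c0 p) (c0 q) (s≤s lt) = size-bit false (size-add⁺-< p q lt)
size-add⁺-< (c0 p) (c1 q) (s≤s lt) = size-bit true  (size-add⁺-< p q lt)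
size-add⁺-< (c1 p) (c0 q) (s≤s lt) = size-bit true  (size-add⁺-< p q lt)
size-add⁺-< (c1 p) (c1 q) (s≤s lt) = size-bit false (size-add⁺-< p q lt)

size-add⁺-≡ : ∀ p q → deg⁺ p ≡ deg⁺ q → size (add⁺ p q) ≤ deg⁺ q
size-add⁺-≡ one    one    _ = z≤n
size-add⁺-≡ (c0 p) (c0 q) e = ℕₚ.≤-trans (size-bit-≤ false _) (s≤s (size-add⁺-≡ p q (ℕₚ.suc-injective e)))
size-add⁺-≡ (c0 p) (c1 q) e = ℕₚ.≤-trans (size-bit-≤ true _)  (s≤s (size-add⁺-≡ p q (ℕₚ.suc-injective e)))
size-add⁺-≡ (c1 p) (c0 q) e = ℕₚ.≤-trans (size-bit-≤ true _)  (s≤s (size-add⁺-≡ p q (ℕₚ.suc-injective e)))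
size-add⁺-≡ (c1 p) (c1 q) e = ℕₚ.≤-trans (size-bit-≤ false _) (s≤s (size-add⁺-≡ p q (ℕₚ.suc-injective e)))

size-+-< : ∀ p q → size p < size q → size (p + q) ≡ size q
size-+-< 0ₚ    q     _        = refl
size-+-< ⟨ p ⟩ ⟨ q ⟩ (s≤s lt) = size-add⁺-< p q lt

size-+-≡ : ∀ p q → q ≢ 0ₚ → size p ≡ size q → size (p + q) < size q
size-+-≡ p     0ₚ    q≢0 _ = ⊥-elim (q≢0 refl)
size-+-≡ ⟨ p ⟩ ⟨ q ⟩ _   e = s≤s (size-add⁺-≡ p q (ℕₚ.suc-injective e))

size-mul⁺ : ∀ p q → size (mul⁺ p ⟨ q ⟩) ≡ suc (deg⁺ p ℕ.+ deg⁺ q)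
size-mul⁺ one    q = refl
size-mul⁺ (c0 p) q = size-bit false (size-mul⁺ p q)
size-mul⁺ (c1 p) q = trans
  (size-+-< ⟨ q ⟩ (shift (mul⁺ p ⟨ q ⟩))
    (subst (suc (deg⁺ q) <_) (sym e) (s≤s (s≤s (ℕₚ.m≤n+m (deg⁺ q) (deg⁺ p))))))
  e
  where
  e : size (shift (mul⁺ p ⟨ q ⟩)) ≡ suc (suc (deg⁺ p ℕ.+ deg⁺ q))
  e = size-bit false (size-mul⁺ p q)

deg : Poly → ℕ
deg 0ₚ    = 0
deg ⟨ p ⟩ = deg⁺ p

size-deg : ∀ {p} → p ≢ 0ₚ → size p ≡ suc (deg p)
size-deg {0ₚ}    p≢0 = ⊥-elim (p≢0 refl)
size-deg {⟨ p ⟩} _   = refl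

deg-* : ∀ {p q} → p ≢ 0ₚ → q ≢ 0ₚ → deg (p * q) ≡ deg p ℕ.+ deg q
deg-* {0ₚ}            p≢0 _   = ⊥-elim (p≢0 refl)
deg-* {⟨ p ⟩} {0ₚ}    _   q≢0 = ⊥-elim (q≢0 refl)
deg-* {⟨ p ⟩} {⟨ q ⟩} _   _   = ℕₚ.suc-injective (trans (sym (size-deg nz)) (size-mul⁺ p q))
  where
  nz : mul⁺ p ⟨ q ⟩ ≢ 0ₚ
  nz e with () ← trans (sym (size-mul⁺ p q)) (cong size e)

*-≢0 : ∀ {p q} → p ≢ 0ₚ → q ≢ 0ₚ → p * q ≢ 0ₚ
*-≢0 {0ₚ}            p≢0 _   _ = p≢0 refl
*-≢0 {⟨ p ⟩} {0ₚ}    _   q≢0 _ = q≢0 refl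
*-≢0 {⟨ p ⟩} {⟨ q ⟩} _   _   e with () ← trans (sym (size-mul⁺ p q)) (cong size e)

*-≢0ˡ : ∀ p q → p * q ≢ 0ₚ → p ≢ 0ₚ
*-≢0ˡ p q nz refl = nz refl

*-≢0ʳ : ∀ p q → p * q ≢ 0ₚ → q ≢ 0ₚ
*-≢0ʳ p q nz refl = nz (*-zeroʳ p)

infix 4 _≟_
_≟_ : (p q : Poly) → Dec (p ≡ q)
0ₚ    ≟ 0ₚ    = yes refl
0ₚ    ≟ ⟨ q ⟩ = no λ ()
⟨ p ⟩ ≟ 0ₚ    = no λ ()
⟨ p ⟩ ≟ ⟨ q ⟩ = map′ (cong ⟨_⟩) (λ { refl → refl }) (p ≟⁺ q)
  where
  _≟⁺_ : (p q : P⁺) → Dec (p ≡ q)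
  one  ≟⁺ one  = yes refl
  one  ≟⁺ c0 q = no λ ()
  one  ≟⁺ c1 q = no λ ()
  c0 p ≟⁺ one  = no λ ()
  c0 p ≟⁺ c0 q = map′ (cong c0) (λ { refl → refl }) (p ≟⁺ q)
  c0 p ≟⁺ c1 q = no λ ()
  c1 p ≟⁺ one  = no λ ()
  c1 p ≟⁺ c0 q = no λ ()
  c1 p ≟⁺ c1 q = map′ (cong c1) (λ { refl → refl }) (p ≟⁺ q)

*-cancelˡ : ∀ p {q r} → p ≢ 0ₚ → p * q ≡ p * r → q ≡ r
*-cancelˡ p {q} {r} p≢0 e with q + r ≟ 0ₚ
... | yes z = +≡0⇒≡ q r z
... | no nz = ⊥-elim (*-≢0 p≢0 nz (begin
  p * (q + r)   ≡⟨ *-distribˡ-+ p q r ⟩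
  p * q + p * r ≡⟨ cong (_+ p * r) e ⟩
  p * r + p * r ≡⟨ +-self (p * r) ⟩
  0ₚ            ∎))
  where open ≡-Reasoning

deg-0⇒1 : ∀ {p} → p ≢ 0ₚ → deg p ≡ 0 → p ≡ 1ₚ
deg-0⇒1 {0ₚ}      p≢0 _ = ⊥-elim (p≢0 refl)
deg-0⇒1 {⟨ one ⟩} _   _ = refl

deg-pos : ∀ {p} → p ≢ 0ₚ → p ≢ 1ₚ → 0 < deg p
deg-pos p≢0 p≢1 = ℕₚ.n≢0⇒n>0 λ e → p≢1 (deg-0⇒1 p≢0 e)

*-≡1ˡ : ∀ p q → p * q ≡ 1ₚ → p ≡ 1ₚ
*-≡1ˡ p q e = deg-0⇒1 p≢0 (ℕₚ.m+n≡0⇒m≡0 (deg p) (trans (sym (deg-* p≢0 q≢0)) (cong deg e)))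
  where
  pq≢0 : p * q ≢ 0ₚ
  pq≢0 z with () ← trans (sym e) z
  p≢0 = *-≢0ˡ p q pq≢0
  q≢0 = *-≢0ʳ p q pq≢0

∣-refl : ∀ {p} → p ∣ p
∣-refl {p} = 1ₚ , *-identityʳ p

∣-trans : ∀ {p q r} → p ∣ q → q ∣ r → p ∣ r
∣-trans {p} (c , refl) (d , refl) = c * d , sym (*-assoc p c d)

∣-*ʳ : ∀ {p q} r → p ∣ q → p ∣ q * r
∣-*ʳ {p} r (c , refl) = c * r , sym (*-assoc p c r)

∣-*ˡ : ∀ {p q} r → p ∣ q → p ∣ r * q
∣-*ˡ {p} {q} r d = subst (p ∣_) (*-comm q r) (∣-*ʳ {p} r d)

∣-+ : ∀ {p q r} → p ∣ q → p ∣ r → p ∣ q + r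
∣-+ {p} (c , refl) (d , refl) = c + d , *-distribˡ-+ p c d

∣-0 : ∀ p → p ∣ 0ₚ
∣-0 p = 0ₚ , *-zeroʳ p

∣-≢0 : ∀ p {q} → p ∣ q → q ≢ 0ₚ → p ≢ 0ₚ
∣-≢0 p (c , e) nz refl = nz (sym e)

∣1⇒≡1 : ∀ p → p ∣ 1ₚ → p ≡ 1ₚ
∣1⇒≡1 p (c , e) = *-≡1ˡ p c e

∣⇒deg-≤ : ∀ p {q} → p ∣ q → q ≢ 0ₚ → deg p ≤ deg q
∣⇒deg-≤ p (c , refl) nz = subst (deg p ≤_) (sym (deg-* (*-≢0ˡ p c nz) (*-≢0ʳ p c nz))) (ℕₚ.m≤m+n (deg p) (deg c))

-- P⁺ lists the constant term first, so structural recursion is long division from the top coefficient down.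
divStep′ : Bool → Poly → Poly → Poly → Poly × Poly
divStep′ true  Q c t = shift c , t
divStep′ false Q c t = cons1 c , t + Q

divStep : Poly → Bool → Poly × Poly → Poly × Poly
divStep Q b (c , r) = divStep′ (size (bit b r) <ᵇ size Q) Q c (bit b r)

divMod⁺ : P⁺ → Poly → Poly × Poly
divMod⁺ one    Q = divStep Q true (0ₚ , 0ₚ)
divMod⁺ (c0 p) Q = divStep Q false (divMod⁺ p Q)
divMod⁺ (c1 p) Q = divStep Q true (divMod⁺ p Q)

divMod : Poly → Poly → Poly × Poly
divMod 0ₚ    Q = 0ₚ , 0ₚ
divMod ⟨ p ⟩ Q = divMod⁺ p Q

infixl 7 _quot_ _mod_
_quot_ _mod_ : Poly → Poly → Poly
p quot Q = proj₁ (divMod p Q)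
p mod  Q = proj₂ (divMod p Q)

IsDivMod : Poly → Poly → Poly × Poly → Set
IsDivMod p Q (c , r) = p ≡ Q * c + r × size r < size Q

divMod-correct : ∀ p Q → Q ≢ 0ₚ → IsDivMod p Q (divMod p Q)
divMod-correct p Q Q≢0 = correct p
  where
  open ≡-Reasoning
  size-Q : 0 < size Q
  size-Q = subst (0 <_) (sym (size-deg Q≢0)) (s≤s z≤n)
  bit-split : ∀ b c r → bit b (Q * c + r) ≡ shift (Q * c) + bit b r
  bit-split b c r = sym (bit-+ false b (Q * c) r)
  cons1-Q : ∀ c → Q * cons1 c ≡ Q + shift (Q * c)
  cons1-Q c = *-bitʳ true Q c
  step′ : ∀ b p c r (small : Bool) → (T small → size (bit b r) < size Q) → (¬ T small → ¬ size (bit b r) < size Q) →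
    IsDivMod p Q (c , r) → IsDivMod (bit b p) Q (divStep′ small Q c (bit b r))
  step′ b p c r true lt _ (e , _) =
    trans (cong (bit b) e) (trans (bit-split b c r) (cong (_+ bit b r) (sym (*-shiftʳ Q c)))) , lt _
  -- `bit b r` has at most one coefficient more than r, so if it is not smaller than Q it has
  -- exactly the size of Q, and one subtraction of Q is enough.
  step′ b p c r false _ ge (e , r<Q) =
    (begin
      bit b p                                       ≡⟨ cong (bit b) e ⟩
      bit b (Q * c + r)                             ≡⟨ bit-split b c r ⟩
      shift (Q * c) + bit b r                       ≡⟨ sym (+-cancel-middle (shift (Q * c)) Q (bit b r)) ⟩
      (shift (Q * c) + Q) + (Q + bit b r)           ≡⟨ cong₂ _+_ (+-comm (shift (Q * c)) Q) (+-comm Q (bit b r)) ⟩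
      (Q + shift (Q * c)) + (bit b r + Q)           ≡⟨ cong (_+ (bit b r + Q)) (sym (cons1-Q c)) ⟩
      Q * cons1 c + (bit b r + Q)                   ∎) ,
    size-+-≡ (bit b r) Q Q≢0
      (ℕₚ.≤-antisym (ℕₚ.≤-trans (size-bit-≤ b r) r<Q) (ℕₚ.≮⇒≥ (ge λ ())))
  step : ∀ b p cr → IsDivMod p Q cr → IsDivMod (bit b p) Q (divStep Q b cr)
  step b p (c , r) = step′ b p c r (size (bit b r) <ᵇ size Q)
    (ℕₚ.<ᵇ⇒< (size (bit b r)) (size Q)) (λ n lt → n (ℕₚ.<⇒<ᵇ lt))
  correct⁺ : ∀ p → IsDivMod ⟨ p ⟩ Q (divMod⁺ p Q)
  correct⁺ one    = step true 0ₚ (0ₚ , 0ₚ) (sym (trans (+-identityʳ (Q * 0ₚ)) (*-zeroʳ Q)) , size-Q)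
  correct⁺ (c0 p) = step false ⟨ p ⟩ _ (correct⁺ p)
  correct⁺ (c1 p) = step true ⟨ p ⟩ _ (correct⁺ p)
  correct : ∀ p → IsDivMod p Q (divMod p Q)
  correct 0ₚ    = sym (trans (+-identityʳ (Q * 0ₚ)) (*-zeroʳ Q)) , size-Q
  correct ⟨ p ⟩ = correct⁺ p

mod-∣ : ∀ p Q → Q ≢ 0ₚ → Q ∣ p + p mod Q
mod-∣ p Q Q≢0 = p quot Q , sym (begin
  p + r               ≡⟨ cong (_+ r) (proj₁ (divMod-correct p Q Q≢0)) ⟩
  (Q * c + r) + r     ≡⟨ +-assoc (Q * c) r r ⟩
  Q * c + (r + r)     ≡⟨ cong (Q * c +_) (+-self r) ⟩
  Q * c + 0ₚ          ≡⟨ +-identityʳ (Q * c) ⟩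
  Q * c               ∎)
  where
  open ≡-Reasoning
  c = p quot Q
  r = p mod Q

∣-small : ∀ p Q → Q ∣ p → size p < size Q → p ≡ 0ₚ
∣-small p Q Q∣p lt with p ≟ 0ₚ
... | yes z = z
... | no nz = ⊥-elim (ℕₚ.<⇒≱ lt (subst₂ _≤_ (sym (size-deg (∣-≢0 Q Q∣p nz))) (sym (size-deg nz)) (s≤s (∣⇒deg-≤ Q Q∣p nz))))

mod≡0⇒∣ : ∀ p Q → Q ≢ 0ₚ → p mod Q ≡ 0ₚ → Q ∣ p
mod≡0⇒∣ p Q Q≢0 e = subst (Q ∣_) (trans (cong (p +_) e) (+-identityʳ p)) (mod-∣ p Q Q≢0)

+-involutive : ∀ p q → (p + q) + p ≡ q
+-involutive p q = begin
  (p + q) + p ≡⟨ cong (_+ p) (+-comm p q) ⟩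
  (q + p) + p ≡⟨ +-assoc q p p ⟩
  q + (p + p) ≡⟨ cong (q +_) (+-self p) ⟩
  q + 0ₚ      ≡⟨ +-identityʳ q ⟩
  q           ∎
  where open ≡-Reasoning

∣-+-cancelˡ : ∀ {Q} p q → Q ∣ p → Q ∣ p + q → Q ∣ q
∣-+-cancelˡ {Q} p q d d′ = subst (Q ∣_) (+-involutive p q) (∣-+ {Q} {p + q} {p} d′ d)

∣⇒mod≡0 : ∀ p Q → Q ≢ 0ₚ → Q ∣ p → p mod Q ≡ 0ₚ
∣⇒mod≡0 p Q Q≢0 d = ∣-small _ Q (∣-+-cancelˡ {Q} p (p mod Q) d (mod-∣ p Q Q≢0)) (proj₂ (divMod-correct p Q Q≢0))

infix 4 _∣?_
_∣?_ : ∀ Q p → Dec (Q ∣ p)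
0ₚ ∣? p = map′ (λ { refl → ∣-refl }) (λ { (c , e) → sym e }) (p ≟ 0ₚ)
⟨ Q ⟩ ∣? p = map′ (mod≡0⇒∣ p ⟨ Q ⟩ λ ()) (∣⇒mod≡0 p ⟨ Q ⟩ λ ()) (p mod ⟨ Q ⟩ ≟ 0ₚ)

-- Unique factorisation and multiplicativity of σ

upToDeg : ℕ → List P⁺
upToDeg zero    = []
upToDeg (suc n) = map c0 (one ∷ upToDeg n) ++ map c1 (one ∷ upToDeg n)

∈-upToDeg⁺ : ∀ n p → 0 < deg⁺ p → deg⁺ p ≤ n → p ∈ upToDeg n
∈-upToDeg⁺ zero    p      pos le       = ⊥-elim (ℕₚ.<⇒≱ pos le)
∈-upToDeg⁺ (suc n) p      pos le       = go p pos le
  where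
  tail : ∀ p → deg⁺ p ≤ n → p ∈ one ∷ upToDeg n
  tail one    _  = here refl
  tail (c0 p) le = there (∈-upToDeg⁺ n (c0 p) (s≤s z≤n) le)
  tail (c1 p) le = there (∈-upToDeg⁺ n (c1 p) (s≤s z≤n) le)
  go : ∀ p → 0 < deg⁺ p → deg⁺ p ≤ suc n → p ∈ upToDeg (suc n)
  go (c0 p) _ (s≤s le) = ∈-++⁺ˡ (∈-map⁺ c0 (tail p le))
  go (c1 p) _ (s≤s le) = ∈-++⁺ʳ (map c0 (one ∷ upToDeg n)) (∈-map⁺ c1 (tail p le))

∈-upToDeg⁻ : ∀ n {p} → p ∈ upToDeg n → 0 < deg⁺ p × deg⁺ p ≤ n
∈-upToDeg⁻ (suc n) m = go (∈-++⁻ (map c0 (one ∷ upToDeg n)) m)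
  where
  tail : ∀ {p} → p ∈ one ∷ upToDeg n → deg⁺ p ≤ n
  tail (here refl) = z≤n
  tail (there k)   = proj₂ (∈-upToDeg⁻ n k)
  go : ∀ {p} → p ∈ map c0 (one ∷ upToDeg n) ⊎ p ∈ map c1 (one ∷ upToDeg n) → 0 < deg⁺ p × deg⁺ p ≤ suc n
  go (inj₁ m′) with _ , k , refl ← ∈-map⁻ c0 m′ = s≤s z≤n , s≤s (tail k)
  go (inj₂ m′) with _ , k , refl ← ∈-map⁻ c1 m′ = s≤s z≤n , s≤s (tail k)

-- Trial division: of two nonconstant factors one has degree at most half. Irreducibility of
-- concrete polynomials is thereby decided by evaluation.
HasSmallFactor : Poly → Set
HasSmallFactor A = Any (λ D → ⟨ D ⟩ ∣ A) (upToDeg ⌊ deg A /2⌋)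

hasSmallFactor? : ∀ A → Dec (HasSmallFactor A)
hasSmallFactor? A = any? (λ D → ⟨ D ⟩ ∣? A) (upToDeg ⌊ deg A /2⌋)

¬smallFactor⇒irreducible : ∀ A → NonConstant A → ¬ HasSmallFactor A → Irreducible A
¬smallFactor⇒irreducible A (A≢0 , A≢1) none = (A≢0 , A≢1) , trivial
  where
  half : ∀ m n → m ≤ n → m ≤ ⌊ m ℕ.+ n /2⌋
  half m n m≤n = subst (_≤ ⌊ m ℕ.+ n /2⌋) (sym (ℕₚ.n≡⌊n+n/2⌋ m)) (ℕₚ.⌊n/2⌋-mono (ℕₚ.+-monoʳ-≤ m m≤n))
  absurd : ∀ B C → B * C ≡ A → B ≢ 1ₚ → deg B ≤ deg C → ⊥
  absurd 0ₚ    C e _   _  = A≢0 (sym e)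
  absurd ⟨ B ⟩ C e B≢1 le = none (lose
    (∈-upToDeg⁺ _ B (deg-pos (λ ()) B≢1)
      (subst (λ d → deg⁺ B ≤ ⌊ d /2⌋)
        (trans (sym (deg-* {⟨ B ⟩} {C} (λ ()) (*-≢0ʳ ⟨ B ⟩ C (A≢0 ∘ trans (sym e))))) (cong deg e))
        (half _ _ le)))
    (C , e))
  trivial : ∀ B C → B * C ≡ A → B ≡ 1ₚ ⊎ C ≡ 1ₚ
  trivial B C e with B ≟ 1ₚ | C ≟ 1ₚ
  ... | yes b | _     = inj₁ b
  ... | no  _ | yes c = inj₂ c
  ... | no  b | no c with ℕₚ.≤-total (deg B) (deg C)
  ...   | inj₁ le = ⊥-elim (absurd B C e b le)
  ...   | inj₂ le = ⊥-elim (absurd C B (trans (*-comm C B) e) c le)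

∃-irreducible-∣ : ∀ A → NonConstant A → ∃ λ P → Irreducible P × P ∣ A
∃-irreducible-∣ A = go (deg A) A ℕₚ.≤-refl
  where
  go : ∀ n A → deg A ≤ n → NonConstant A → ∃ λ P → Irreducible P × P ∣ A
  go n A le (A≢0 , A≢1) with hasSmallFactor? A
  ... | no none = A , ¬smallFactor⇒irreducible A (A≢0 , A≢1) none , ∣-refl
  go zero A le (A≢0 , A≢1) | yes some = ⊥-elim (A≢1 (deg-0⇒1 A≢0 (ℕₚ.n≤0⇒n≡0 le)))
  go (suc n) A le (A≢0 , A≢1) | yes some with D , D∈ , D∣A ← find some
    with 0<D , D≤ ← ∈-upToDeg⁻ _ D∈
    with P , irr , P∣D ← go n ⟨ D ⟩
      (ℕₚ.≤-trans (ℕₚ.≤-trans D≤ (ℕₚ.⌊n/2⌋-mono le)) (ℕₚ.≤-pred (ℕₚ.⌊n/2⌋<n n)))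
      ((λ ()) , λ { refl → ℕₚ.<⇒≢ 0<D refl })
    = P , irr , ∣-trans {P} P∣D D∣A

irreducible-∣ : ∀ {P Q} → Irreducible P → Irreducible Q → P ∣ Q → P ≡ Q
irreducible-∣ {P} ((_ , P≢1) , _) (_ , splitQ) (C , e) with splitQ P C e
... | inj₁ p = ⊥-elim (P≢1 p)
... | inj₂ refl = trans (sym (*-identityʳ P)) e

size-<⇒deg-< : ∀ {p q} → p ≢ 0ₚ → size p < size q → deg p < deg q
size-<⇒deg-< {0ₚ}            nz _        = ⊥-elim (nz refl)
size-<⇒deg-< {⟨ p ⟩} {⟨ q ⟩} _  (s≤s lt) = lt

module _ {P} (irr : Irreducible P) where
  private
    P≢0 = proj₁ (proj₁ irr)
    P≢1 = proj₂ (proj₁ irr)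

  -- Replacing A by P mod A keeps the hypothesis P ∣ A * B and lowers the degree.
  euclid-small : ∀ n A B → A ≢ 0ₚ → size A < size P → deg A ≤ n → P ∣ A * B → P ∣ B
  euclid-small n A B A≢0 A<P le P∣AB with A ≟ 1ₚ
  ... | yes refl = P∣AB
  euclid-small zero A B A≢0 A<P le P∣AB | no A≢1 = ⊥-elim (A≢1 (deg-0⇒1 A≢0 (ℕₚ.n≤0⇒n≡0 le)))
  euclid-small (suc n) A B A≢0 A<P le P∣AB | no A≢1 with P mod A ≟ 0ₚ
  ... | yes r≡0 with mod≡0⇒∣ P A A≢0 r≡0
  ...   | C , e with proj₂ irr A C e
  ...     | inj₁ A≡1  = ⊥-elim (A≢1 A≡1)
  ...     | inj₂ refl = ⊥-elim (ℕₚ.<-irrefl (cong size (trans (sym (*-identityʳ A)) e)) A<P)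
  euclid-small (suc n) A B A≢0 A<P le P∣AB | no A≢1 | no r≢0 =
    euclid-small n r B r≢0 (ℕₚ.<-trans r<A A<P)
      (ℕₚ.≤-pred (ℕₚ.≤-trans (size-<⇒deg-< r≢0 r<A) le)) P∣rB
    where
    open ≡-Reasoning
    r = P mod A
    r<A = proj₂ (divMod-correct P A A≢0)
    P∣rB : P ∣ r * B
    P∣rB with C , e ← mod-∣ P A A≢0 = ∣-+-cancelˡ {P} (P * B) (r * B) (∣-*ʳ {P} {P} B ∣-refl)
      (subst (P ∣_) (begin
        C * (A * B)   ≡⟨ sym (*-assoc C A B) ⟩
        C * A * B     ≡⟨ cong (_* B) (trans (*-comm C A) e) ⟩
        (P + r) * B   ≡⟨ *-distribʳ-+ B P r ⟩
        P * B + r * B ∎) (∣-*ˡ {P} C P∣AB))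

  euclid : ∀ A B → P ∣ A * B → P ∣ A ⊎ P ∣ B
  euclid A B P∣AB with P ∣? A
  ... | yes d = inj₁ d
  ... | no nd = inj₂ (euclid-small (deg r) r B r≢0 (proj₂ (divMod-correct A P P≢0)) ℕₚ.≤-refl
          (∣-+-cancelˡ {P} (A * B) (r * B) P∣AB
            (subst (P ∣_) (*-distribʳ-+ B A r) (∣-*ʳ {P} B (mod-∣ A P P≢0)))))
    where
    r = A mod P
    r≢0 : r ≢ 0ₚ
    r≢0 e = nd (mod≡0⇒∣ A P P≢0 e)

  euclid-^ : ∀ A n → P ∣ A ^ n → P ∣ A
  euclid-^ A zero    d = ⊥-elim (P≢1 (∣1⇒≡1 P d))
  euclid-^ A (suc n) d with euclid A (A ^ n) d
  ... | inj₁ d′ = d′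
  ... | inj₂ d′ = euclid-^ A n d′

^-+ : ∀ p m n → p ^ (m ℕ.+ n) ≡ p ^ m * p ^ n
^-+ p zero    n = refl
^-+ p (suc m) n = trans (cong (p *_) (^-+ p m n)) (sym (*-assoc p (p ^ m) (p ^ n)))

^-* : ∀ p m n → p ^ (m ℕ.* n) ≡ (p ^ n) ^ m
^-* p zero    n = refl
^-* p (suc m) n = trans (^-+ p n (m ℕ.* n)) (cong (p ^ n *_) (^-* p m n))

*-^ : ∀ p q n → (p * q) ^ n ≡ p ^ n * q ^ n
*-^ p q zero    = refl
*-^ p q (suc n) = trans (cong (p * q *_) (*-^ p q n)) (*-interchange p q (p ^ n) (q ^ n))

1-^ : ∀ n → 1ₚ ^ n ≡ 1ₚ
1-^ zero    = refl
1-^ (suc n) = 1-^ n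

^-≢0 : ∀ {p} n → p ≢ 0ₚ → p ^ n ≢ 0ₚ
^-≢0 zero    nz ()
^-≢0 (suc n) nz = *-≢0 nz (^-≢0 n nz)

Val : Poly → Poly → ℕ → Set
Val P A k = ∃ λ B → A ≡ P ^ k * B × ¬ (P ∣ B)

module _ {P} (irr : Irreducible P) where
  private
    P≢0 = proj₁ (proj₁ irr)
    P≢1 = proj₂ (proj₁ irr)

  val-exists : ∀ A → A ≢ 0ₚ → ∃ (Val P A)
  val-exists A = go (deg A) A ℕₚ.≤-refl
    where
    go : ∀ n A → deg A ≤ n → A ≢ 0ₚ → ∃ (Val P A)
    go n A le A≢0 with P ∣? A
    ... | no nd = 0 , A , refl , nd
    go zero A le A≢0 | yes (B , e) = ⊥-elim (P≢1 (*-≡1ˡ P B (trans e (deg-0⇒1 A≢0 (ℕₚ.n≤0⇒n≡0 le)))))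
    go (suc n) A le A≢0 | yes (B , refl) with k , C , refl , nd ← go n B
      (ℕₚ.≤-pred (ℕₚ.≤-trans (ℕₚ.+-monoˡ-≤ (deg B) (deg-pos P≢0 P≢1))
        (subst (_≤ suc n) (deg-* P≢0 (*-≢0ʳ P B A≢0)) le)))
      (*-≢0ʳ P B A≢0) = suc k , C , sym (*-assoc P (P ^ k) C) , nd

  val-unique : ∀ {A k l} → Val P A k → Val P A l → k ≡ l
  val-unique {k = k} {l} (B , refl , ndB) (C , e , ndC) = go k l e
    where
    go : ∀ k l → P ^ k * B ≡ P ^ l * C → k ≡ l
    go zero    zero    e = refl
    go zero    (suc l) e = ⊥-elim (ndB (P ^ l * C , trans (sym (*-assoc P (P ^ l) C)) (sym e)))
    go (suc k) zero    e = ⊥-elim (ndC (P ^ k * B , trans (sym (*-assoc P (P ^ k) B)) e))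
    go (suc k) (suc l) e = cong suc (go k l (*-cancelˡ P P≢0
      (trans (sym (*-assoc P (P ^ k) B)) (trans e (*-assoc P (P ^ l) C)))))

  val-* : ∀ {A B k l} → Val P A k → Val P B l → Val P (A * B) (k ℕ.+ l)
  val-* {k = k} {l} (C , refl , ndC) (D , refl , ndD) = C * D ,
    trans (*-interchange (P ^ k) C (P ^ l) D) (cong (_* (C * D)) (sym (^-+ P k l))) ,
    λ d → case euclid irr C D d of λ { (inj₁ c) → ndC c ; (inj₂ c) → ndD c }

  val-0 : ∀ {A} → ¬ P ∣ A → Val P A 0
  val-0 {A} nd = A , refl , nd

-- 1 + P + ... + P^k, that is σ(P^k) for irreducible P; it has k + 1 terms.
geom : Poly → ℕ → Poly
geom P zero    = 1ₚ
geom P (suc k) = 1ₚ + P * geom P k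

sumₚ-++ : ∀ L M → sumₚ (L ++ M) ≡ sumₚ L + sumₚ M
sumₚ-++ []      M = refl
sumₚ-++ (D ∷ L) M = trans (cong (D +_) (sumₚ-++ L M)) (sym (+-assoc D (sumₚ L) (sumₚ M)))

sumₚ-map-* : ∀ P L → sumₚ (map (P *_) L) ≡ P * sumₚ L
sumₚ-map-* P []      = sym (*-zeroʳ P)
sumₚ-map-* P (D ∷ L) = trans (cong (P * D +_) (sumₚ-map-* P L)) (sym (*-distribˡ-+ P D (sumₚ L)))

sigma-unique : ∀ {A S S′} → SigmaIs A S → SigmaIs A S′ → S ≡ S′
sigma-unique (L , uL , memL , refl) (M , uM , memM , refl) =
  foldr-commMonoid (setoid Poly) (CommutativeRing.+-isCommutativeMonoid 𝔽₂[x])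
    (↭⇒↭ₛ (∼bag⇒↭ (unique∧set⇒bag uL uM
      λ {D} → mk⇔ (Equivalence.from (memM D) ∘ Equivalence.to (memL D))
                  (Equivalence.from (memL D) ∘ Equivalence.to (memM D)))))

sigma-1 : SigmaIs 1ₚ 1ₚ
sigma-1 = 1ₚ ∷ [] , [] ∷ [] ,
  (λ D → mk⇔ (λ { (here refl) → (λ ()) , ∣-refl })
             (λ { (_ , d) → here (∣1⇒≡1 D d) })) , refl

-- A divisor of P^(k+1) B either is prime to P, and then divides B, or is P times a divisor of P^k
-- B. Hence the recursion S + P (geom P k) S.
sigma-step : ∀ {P B S} → Irreducible P → B ≢ 0ₚ → ¬ P ∣ B → SigmaIs B S →
  ∀ k → SigmaIs (P ^ k * B) (geom P k * S)
sigma-step irr B≢0 nd σB zero = σB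
sigma-step {P} {B} {S} irr B≢0 nd σB@(L , uL , memL , sumL) (suc k)
  with M , uM , memM , sumM ← sigma-step irr B≢0 nd σB k
  = L ++ map (P *_) M
  , Uniqueₚ.++⁺ uL (Uniqueₚ.map⁺ (*-cancelˡ P P≢0) uM) disjoint
  , (λ D → mk⇔ (to D ∘ ∈-++⁻ L) (from D))
  , (begin
      sumₚ (L ++ map (P *_) M)     ≡⟨ sumₚ-++ L (map (P *_) M) ⟩
      sumₚ L + sumₚ (map (P *_) M) ≡⟨ cong₂ _+_ sumL (sumₚ-map-* P M) ⟩
      S + P * sumₚ M               ≡⟨ cong (λ t → S + P * t) sumM ⟩
      S + P * (geom P k * S)       ≡⟨ cong (S +_) (sym (*-assoc P (geom P k) S)) ⟩
      S + P * geom P k * S         ≡⟨ sym (*-distribʳ-+ S 1ₚ (P * geom P k)) ⟩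
      geom P (suc k) * S           ∎)
  where
  open ≡-Reasoning
  P≢0 = proj₁ (proj₁ irr)
  disjoint : ∀ {D} → D ∈ L × D ∈ map (P *_) M → ⊥
  disjoint (D∈L , D∈PM) with E , _ , refl ← ∈-map⁻ (P *_) D∈PM =
    nd (∣-trans {P} (E , refl) (proj₂ (Equivalence.to (memL _) D∈L)))
  assoc = *-assoc P (P ^ k) B
  to : ∀ D → D ∈ L ⊎ D ∈ map (P *_) M → Monic D × D ∣ P ^ suc k * B
  to D (inj₁ m) with mon , d ← Equivalence.to (memL D) m = mon , ∣-*ˡ {D} (P ^ suc k) d
  to D (inj₂ m) with E , E∈ , refl ← ∈-map⁻ (P *_) m
    with mon , (C , e) ← Equivalence.to (memM E) E∈ =
    *-≢0 P≢0 mon , C , trans (*-assoc P E C) (trans (cong (P *_) e) (sym assoc))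
  coprime-part : ∀ D C n → ¬ P ∣ D → D * C ≡ P ^ n * B → D ∣ B
  coprime-part D C zero    ndD e = C , e
  coprime-part D C (suc n) ndD e with euclid irr D C (P ^ n * B , trans (sym (*-assoc P (P ^ n) B)) (sym e))
  ... | inj₁ d = ⊥-elim (ndD d)
  ... | inj₂ (C′ , refl) = coprime-part D C′ n ndD (*-cancelˡ P P≢0
          (trans (*-swapˡ P D C′) (trans e (*-assoc P (P ^ n) B))))
  from : ∀ D → Monic D × D ∣ P ^ suc k * B → D ∈ L ++ map (P *_) M
  from D (mon , C , e) with P ∣? D
  ... | no  ndD = ∈-++⁺ˡ (Equivalence.from (memL D) (mon , coprime-part D C (suc k) ndD e))
  ... | yes (E , refl) = ∈-++⁺ʳ L (∈-map⁺ (P *_) (Equivalence.from (memM E)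
          (*-≢0ʳ P E mon , C , *-cancelˡ P P≢0 (trans (sym (*-assoc P E C)) (trans e assoc)))))

-- Geometric sums, Frobenius and Fermat

geom-telescope : ∀ P k → (1ₚ + P) * geom P k ≡ 1ₚ + P ^ suc k
geom-telescope P zero    = trans (*-identityʳ (1ₚ + P)) (cong (1ₚ +_) (sym (*-identityʳ P)))
geom-telescope P (suc k) = begin
  (1ₚ + P) * (1ₚ + P * geom P k)           ≡⟨ *-distribˡ-+ (1ₚ + P) 1ₚ (P * geom P k) ⟩
  (1ₚ + P) * 1ₚ + (1ₚ + P) * (P * geom P k) ≡⟨ cong₂ _+_ (*-identityʳ (1ₚ + P)) (*-swapˡ (1ₚ + P) P (geom P k)) ⟩
  (1ₚ + P) + P * ((1ₚ + P) * geom P k)     ≡⟨ cong (λ t → (1ₚ + P) + P * t) (geom-telescope P k) ⟩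
  (1ₚ + P) + P * (1ₚ + P ^ suc k)          ≡⟨ cong ((1ₚ + P) +_) (*-distribˡ-+ P 1ₚ (P ^ suc k)) ⟩
  (1ₚ + P) + (P * 1ₚ + P ^ suc (suc k))    ≡⟨ cong (λ t → (1ₚ + P) + (t + P ^ suc (suc k))) (*-identityʳ P) ⟩
  (1ₚ + P) + (P + P ^ suc (suc k))         ≡⟨ +-cancel-middle 1ₚ P (P ^ suc (suc k)) ⟩
  1ₚ + P ^ suc (suc k)                     ∎
  where open ≡-Reasoning

square-+ : ∀ p q → (p + q) ^ 2 ≡ p ^ 2 + q ^ 2
square-+ p q = begin
  (p + q) * ((p + q) * 1ₚ)              ≡⟨ cong ((p + q) *_) (*-identityʳ (p + q)) ⟩
  (p + q) * (p + q)                     ≡⟨ *-distribˡ-+ (p + q) p q ⟩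
  (p + q) * p + (p + q) * q             ≡⟨ cong₂ _+_ (*-distribʳ-+ p p q) (*-distribʳ-+ q p q) ⟩
  (p * p + q * p) + (p * q + q * q)     ≡⟨ cong (λ t → (p * p + t) + (p * q + q * q)) (*-comm q p) ⟩
  (p * p + p * q) + (p * q + q * q)     ≡⟨ +-cancel-middle (p * p) (p * q) (q * q) ⟩
  p * p + q * q                         ≡⟨ cong₂ (λ s t → p * s + q * t) (sym (*-identityʳ p)) (sym (*-identityʳ q)) ⟩
  p ^ 2 + q ^ 2                         ∎
  where open ≡-Reasoning

frobenius : ∀ n p q → (p + q) ^ (2 ℕ.^ n) ≡ p ^ (2 ℕ.^ n) + q ^ (2 ℕ.^ n)
frobenius zero p q = trans (*-identityʳ (p + q)) (cong₂ _+_ (sym (*-identityʳ p)) (sym (*-identityʳ q)))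
frobenius (suc n) p q = begin
  (p + q) ^ (2 ℕ.* 2 ℕ.^ n)                     ≡⟨ ^-* (p + q) 2 (2 ℕ.^ n) ⟩
  ((p + q) ^ (2 ℕ.^ n)) ^ 2                     ≡⟨ cong (_^ 2) (frobenius n p q) ⟩
  (p ^ (2 ℕ.^ n) + q ^ (2 ℕ.^ n)) ^ 2           ≡⟨ square-+ (p ^ (2 ℕ.^ n)) (q ^ (2 ℕ.^ n)) ⟩
  (p ^ (2 ℕ.^ n)) ^ 2 + (q ^ (2 ℕ.^ n)) ^ 2     ≡⟨ cong₂ _+_ (sym (^-* p 2 (2 ℕ.^ n))) (sym (^-* q 2 (2 ℕ.^ n))) ⟩
  p ^ (2 ℕ.* 2 ℕ.^ n) + q ^ (2 ℕ.* 2 ℕ.^ n)     ∎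
  where open ≡-Reasoning

1+≢0 : ∀ {P} → NonConstant P → 1ₚ + P ≢ 0ₚ
1+≢0 {P} (_ , P≢1) e = P≢1 (sym (+≡0⇒≡ 1ₚ P e))

^-nonConstant : ∀ {P} k → NonConstant P → NonConstant (P ^ suc k)
^-nonConstant {P} k (P≢0 , P≢1) = ^-≢0 (suc k) P≢0 , λ e → P≢1 (*-≡1ˡ P (P ^ k) e)

geom-* : ∀ {P} → NonConstant P → ∀ j k l → suc l ≡ suc j ℕ.* suc k →
  geom P l ≡ geom P j * geom (P ^ suc j) k
geom-* {P} nc j k l e = *-cancelˡ (1ₚ + P) (1+≢0 nc) (begin
  (1ₚ + P) * geom P l                       ≡⟨ geom-telescope P l ⟩
  1ₚ + P ^ suc l                            ≡⟨ cong (λ n → 1ₚ + P ^ n) (trans e (ℕₚ.*-comm (suc j) (suc k))) ⟩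
  1ₚ + P ^ (suc k ℕ.* suc j)                ≡⟨ cong (1ₚ +_) (^-* P (suc k) (suc j)) ⟩
  1ₚ + (P ^ suc j) ^ suc k                  ≡⟨ sym (geom-telescope (P ^ suc j) k) ⟩
  (1ₚ + P ^ suc j) * geom (P ^ suc j) k     ≡⟨ cong (_* geom (P ^ suc j) k) (sym (geom-telescope P j)) ⟩
  (1ₚ + P) * geom P j * geom (P ^ suc j) k  ≡⟨ *-assoc (1ₚ + P) (geom P j) _ ⟩
  (1ₚ + P) * (geom P j * geom (P ^ suc j) k) ∎)
  where open ≡-Reasoning

-- By Frobenius 1 + P^(2^n u) = (1 + P^u)^(2^n); telescoping both sides and cancelling one factor 1
-- + P leaves the exponent 2^n - 1.
geom-2^ : ∀ {P} → NonConstant P → ∀ n v l → suc l ≡ 2 ℕ.^ n ℕ.* suc v →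
  geom P l ≡ (1ₚ + P) ^ (2 ℕ.^ n ∸ 1) * geom P v ^ (2 ℕ.^ n)
geom-2^ {P} nc n v l e = *-cancelˡ (1ₚ + P) (1+≢0 nc) (begin
  (1ₚ + P) * geom P l                            ≡⟨ geom-telescope P l ⟩
  1ₚ + P ^ suc l                                 ≡⟨ cong (λ m → 1ₚ + P ^ m) e ⟩
  1ₚ + P ^ (N ℕ.* suc v)                         ≡⟨ cong₂ _+_ (sym (1-^ N)) (^-* P N (suc v)) ⟩
  1ₚ ^ N + (P ^ suc v) ^ N                       ≡⟨ sym (frobenius n 1ₚ (P ^ suc v)) ⟩
  (1ₚ + P ^ suc v) ^ N                           ≡⟨ cong (_^ N) (sym (geom-telescope P v)) ⟩
  ((1ₚ + P) * geom P v) ^ N                      ≡⟨ *-^ (1ₚ + P) (geom P v) N ⟩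
  (1ₚ + P) ^ N * geom P v ^ N                    ≡⟨ cong (λ m → (1ₚ + P) ^ m * geom P v ^ N) (sym (ℕₚ.m+[n∸m]≡n (ℕₚ.m^n>0 2 n))) ⟩
  (1ₚ + P) * (1ₚ + P) ^ (N ∸ 1) * geom P v ^ N   ≡⟨ *-assoc (1ₚ + P) _ _ ⟩
  (1ₚ + P) * ((1ₚ + P) ^ (N ∸ 1) * geom P v ^ N) ∎)
  where
  open ≡-Reasoning
  N = 2 ℕ.^ n

geom-nonConstant : ∀ {P} → NonConstant P → ∀ k → 0 < k → NonConstant (geom P k)
geom-nonConstant {P} nc (suc k) _ = ≢0 (suc k) , ≢1
  where
  ≢0 : ∀ k → geom P k ≢ 0ₚ
  ≢0 k e = 1+≢0 (^-nonConstant k nc)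
    (trans (sym (geom-telescope P k)) (trans (cong ((1ₚ + P) *_) e) (*-zeroʳ (1ₚ + P))))
  ≢1 : geom P (suc k) ≢ 1ₚ
  ≢1 e = *-≢0 (proj₁ nc) (≢0 k) (trans (sym (+-involutive 1ₚ _)) (cong (_+ 1ₚ) e))

-- Modulo 1 + P every power of P is 1, and a sum of 2k + 1 ones is 1.
∣1+geom-even : ∀ P k → (1ₚ + P) ∣ geom P (k ℕ.+ k) + 1ₚ
∣1+geom-even P zero    = ∣-0 (1ₚ + P)
∣1+geom-even P (suc k) = subst ((1ₚ + P) ∣_) (begin
  P * (1ₚ + P * g)       ≡⟨ sym (+-involutive 1ₚ _) ⟩
  (1ₚ + P * (1ₚ + P * g)) + 1ₚ ≡⟨ cong (λ m → geom P (suc m) + 1ₚ) (sym (ℕₚ.+-suc k k)) ⟩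
  geom P (suc k ℕ.+ suc k) + 1ₚ  ∎)
  (∣-*ˡ {1ₚ + P} P (subst ((1ₚ + P) ∣_) eq
    (∣-+ {1ₚ + P} (∣-*ˡ {1ₚ + P} P (∣1+geom-even P k)) ∣-refl)))
  where
  open ≡-Reasoning
  g = geom P (k ℕ.+ k)
  eq : P * (g + 1ₚ) + (1ₚ + P) ≡ 1ₚ + P * g
  eq = begin
    P * (g + 1ₚ) + (1ₚ + P)       ≡⟨ cong₂ _+_ (*-distribˡ-+ P g 1ₚ) (+-comm 1ₚ P) ⟩
    (P * g + P * 1ₚ) + (P + 1ₚ)   ≡⟨ cong (λ t → (P * g + t) + (P + 1ₚ)) (*-identityʳ P) ⟩
    (P * g + P) + (P + 1ₚ)        ≡⟨ +-cancel-middle (P * g) P 1ₚ ⟩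
    P * g + 1ₚ                    ≡⟨ +-comm (P * g) 1ₚ ⟩
    1ₚ + P * g                    ∎

odd-suc : ∀ {m} → Oddℕ (suc m) → ∃ λ k → m ≡ k ℕ.+ k
odd-suc {m} odd with even-or-odd m
... | inj₁ r = r
... | inj₂ (k , refl) = ⊥-elim (odd (divides (suc k)
        (trans (cong suc (sym (ℕₚ.+-suc k k))) (trans (cong (suc k ℕ.+_) (sym (ℕₚ.+-identityʳ (suc k)))) (ℕₚ.*-comm 2 (suc k))))))

-- Congruence to 1 modulo Q is written Q ∣ 1ₚ + p.
∣1+^ : ∀ Q p n → Q ∣ 1ₚ + p → Q ∣ 1ₚ + p ^ n
∣1+^ Q p zero    d = ∣-0 Q
∣1+^ Q p (suc n) d = subst (Q ∣_) (geom-telescope p n) (∣-*ʳ {Q} (geom p n) d)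

-- Bézout without inverses: p^(1 + yn) ≡ 1 and p^(yn) ≡ 1 modulo Q, and multiplying the latter by p
-- gives p ≡ 1.
∣1+-Bézout : ∀ Q p m n x y → 1 ℕ.+ y ℕ.* n ≡ x ℕ.* m → Q ∣ 1ₚ + p ^ m → Q ∣ 1ₚ + p ^ n → Q ∣ 1ₚ + p
∣1+-Bézout Q p m n x y e dm dn = subst (Q ∣_) eq
  (∣-+ {Q} (subst (λ k → Q ∣ 1ₚ + k) (trans (sym (^-* p x m)) (cong (p ^_) (sym e))) (∣1+^ Q (p ^ m) x dm))
    (∣-*ˡ {Q} p (subst (λ k → Q ∣ 1ₚ + k) (sym (^-* p y n)) (∣1+^ Q (p ^ n) y dn))))
  where
  open ≡-Reasoning
  z = p ^ (y ℕ.* n)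
  eq : (1ₚ + p * z) + p * (1ₚ + z) ≡ 1ₚ + p
  eq = begin
    (1ₚ + p * z) + p * (1ₚ + z)         ≡⟨ cong ((1ₚ + p * z) +_) (*-distribˡ-+ p 1ₚ z) ⟩
    (1ₚ + p * z) + (p * 1ₚ + p * z)     ≡⟨ cong (λ t → (1ₚ + p * z) + (t + p * z)) (*-identityʳ p) ⟩
    (1ₚ + p * z) + (p + p * z)          ≡⟨ cong ((1ₚ + p * z) +_) (+-comm p (p * z)) ⟩
    (1ₚ + p * z) + (p * z + p)          ≡⟨ +-cancel-middle 1ₚ (p * z) p ⟩
    1ₚ + p                              ∎

∣1+-coprime : ∀ Q p m n → Coprimeℕ m n → Q ∣ 1ₚ + p ^ m → Q ∣ 1ₚ + p ^ n → Q ∣ 1ₚ + p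
∣1+-coprime Q p m n c dm dn with coprime-Bézout c
... | Bézout.+- x y e = ∣1+-Bézout Q p m n x y e dm dn
... | Bézout.-+ x y e = ∣1+-Bézout Q p n m y x e dn dm

prime∤⇒coprime : ∀ {r u} → Primeℕ r → ¬ r ∣ℕ u → Coprimeℕ r u
prime∤⇒coprime pr nd (d∣r , d∣u) with prime⇒irreducible pr d∣r
... | inj₁ d≡1  = d≡1
... | inj₂ refl = ⊥-elim (nd d∣u)

-- The factors r are removed one at a time: p^(product rs) has r-th and u-th power 1 with r and u
-- coprime, so it is 1 itself.
∣1+-product : ∀ Q u rs → All Primeℕ rs → All (λ r → ¬ r ∣ℕ u) rs → ∀ p →
  Q ∣ 1ₚ + p ^ product rs → Q ∣ 1ₚ + p ^ u → Q ∣ 1ₚ + p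
∣1+-product Q u []       _          _          p dr du = subst (λ t → Q ∣ 1ₚ + t) (*-identityʳ p) dr
∣1+-product Q u (r ∷ rs) (pr ∷ prs) (nd ∷ nds) p dr du =
  ∣1+-product Q u rs prs nds p
    (∣1+-coprime Q (p ^ product rs) r u (prime∤⇒coprime pr nd)
      (subst (λ t → Q ∣ 1ₚ + t) (^-* p r (product rs)) dr)
      (subst (λ t → Q ∣ 1ₚ + t) (trans (sym (^-* p (product rs) u))
          (trans (cong (p ^_) (ℕₚ.*-comm (product rs) u)) (^-* p u (product rs))))
        (∣1+^ Q (p ^ u) (product rs) du)))
    du

-- Raising to the power 2^k is additive and multiplicative, so if it fixes X modulo Q it fixes every
-- polynomial, by induction on the Horner form.
frobenius-fixed : ∀ Q k → Q ∣ X ^ (2 ℕ.^ k) + X → ∀ p → Q ∣ ⟨ p ⟩ ^ (2 ℕ.^ k) + ⟨ p ⟩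
frobenius-fixed Q k fixX = go
  where
  open ≡-Reasoning
  N = 2 ℕ.^ k
  goX : ∀ p → Q ∣ ⟨ p ⟩ ^ N + ⟨ p ⟩ → Q ∣ (X * ⟨ p ⟩) ^ N + X * ⟨ p ⟩
  goX p d = subst (Q ∣_) (begin
      (X ^ N + X) * ⟨ p ⟩ ^ N + X * (⟨ p ⟩ ^ N + ⟨ p ⟩)
        ≡⟨ cong₂ _+_ (*-distribʳ-+ (⟨ p ⟩ ^ N) (X ^ N) X) (*-distribˡ-+ X (⟨ p ⟩ ^ N) ⟨ p ⟩) ⟩
      (X ^ N * ⟨ p ⟩ ^ N + X * ⟨ p ⟩ ^ N) + (X * ⟨ p ⟩ ^ N + X * ⟨ p ⟩)
        ≡⟨ +-cancel-middle (X ^ N * ⟨ p ⟩ ^ N) (X * ⟨ p ⟩ ^ N) (X * ⟨ p ⟩) ⟩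
      X ^ N * ⟨ p ⟩ ^ N + X * ⟨ p ⟩
        ≡⟨ cong (_+ X * ⟨ p ⟩) (sym (*-^ X ⟨ p ⟩ N)) ⟩
      (X * ⟨ p ⟩) ^ N + X * ⟨ p ⟩ ∎)
    (∣-+ {Q} (∣-*ʳ {Q} (⟨ p ⟩ ^ N) fixX) (∣-*ˡ {Q} X d))
  go : ∀ p → Q ∣ ⟨ p ⟩ ^ N + ⟨ p ⟩
  go one    = subst (λ t → Q ∣ t + 1ₚ) (sym (1-^ N)) (∣-0 Q)
  go (c0 p) = goX p (go p)
  go (c1 p) = subst (Q ∣_) (begin
      (X * ⟨ p ⟩) ^ N + X * ⟨ p ⟩                   ≡⟨ sym (+-cancel-middle ((X * ⟨ p ⟩) ^ N) 1ₚ (X * ⟨ p ⟩)) ⟩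
      ((X * ⟨ p ⟩) ^ N + 1ₚ) + (1ₚ + X * ⟨ p ⟩)     ≡⟨ cong (_+ (1ₚ + X * ⟨ p ⟩)) (+-comm ((X * ⟨ p ⟩) ^ N) 1ₚ) ⟩
      (1ₚ + (X * ⟨ p ⟩) ^ N) + (1ₚ + X * ⟨ p ⟩)     ≡⟨ cong (λ t → (t + (X * ⟨ p ⟩) ^ N) + (1ₚ + X * ⟨ p ⟩)) (sym (1-^ N)) ⟩
      (1ₚ ^ N + (X * ⟨ p ⟩) ^ N) + (1ₚ + X * ⟨ p ⟩) ≡⟨ cong (_+ (1ₚ + X * ⟨ p ⟩)) (sym (frobenius k 1ₚ (X * ⟨ p ⟩))) ⟩
      (1ₚ + X * ⟨ p ⟩) ^ N + (1ₚ + X * ⟨ p ⟩)       ∎)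
    (goX p (go p))

-- The congruence for X stands in for counting residues modulo Q and is checked by evaluation for
-- each allowed prime. It gives p^(2^k) ≡ p, and p cancels because Q is irreducible.
fermat : ∀ {Q} → Irreducible Q → ∀ k → Q ∣ X ^ (2 ℕ.^ k) + X → ∀ p → ¬ Q ∣ p → Q ∣ 1ₚ + p ^ (2 ℕ.^ k ∸ 1)
fermat {Q} irr k fixX 0ₚ    nd = ⊥-elim (nd (∣-0 Q))
fermat {Q} irr k fixX ⟨ p ⟩ nd with euclid irr ⟨ p ⟩ (1ₚ + ⟨ p ⟩ ^ (2 ℕ.^ k ∸ 1))
  (subst (Q ∣_) (begin
    ⟨ p ⟩ ^ N + ⟨ p ⟩                       ≡⟨ cong (λ m → ⟨ p ⟩ ^ m + ⟨ p ⟩) (sym (ℕₚ.m+[n∸m]≡n (ℕₚ.m^n>0 2 k))) ⟩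
    ⟨ p ⟩ * ⟨ p ⟩ ^ (N ∸ 1) + ⟨ p ⟩         ≡⟨ +-comm (⟨ p ⟩ * ⟨ p ⟩ ^ (N ∸ 1)) ⟨ p ⟩ ⟩
    ⟨ p ⟩ + ⟨ p ⟩ * ⟨ p ⟩ ^ (N ∸ 1)         ≡⟨ cong (_+ ⟨ p ⟩ * ⟨ p ⟩ ^ (N ∸ 1)) (sym (*-identityʳ ⟨ p ⟩)) ⟩
    ⟨ p ⟩ * 1ₚ + ⟨ p ⟩ * ⟨ p ⟩ ^ (N ∸ 1)    ≡⟨ sym (*-distribˡ-+ ⟨ p ⟩ 1ₚ _) ⟩
    ⟨ p ⟩ * (1ₚ + ⟨ p ⟩ ^ (N ∸ 1))          ∎)
    (frobenius-fixed Q k fixX p))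
  where
  open ≡-Reasoning
  N = 2 ℕ.^ k
... | inj₁ d = ⊥-elim (nd d)
... | inj₂ d = d

-- Products of allowed primes

poly : Prime → Poly
poly x₀  = X
poly x₁  = X + 1ₚ
poly m₁  = M₁
poly m₂  = M₂
poly m₃  = M₃
poly m₄  = M₄
poly m₅  = M₅
poly m₆  = M₆
poly m₇  = M₇
poly m₈  = M₈
poly m₉  = M₉
poly m₁₀ = M₁₀
poly m₁₁ = M₁₁
poly m₁₂ = M₁₂
poly m₁₃ = M₁₃
poly s₁  = S₁
poly s₂  = S₂
poly s₃  = S₃
poly s₄  = S₄
poly s₅  = S₅
poly s₆  = S₆
poly s₇  = S₇
poly s₈  = S₈
poly s₉  = S₉
poly s₁₀ = S₁₀
poly s₁₁ = S₁₁
poly s₁₂ = S₁₂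
poly s₁₃ = S₁₃
poly s₁₄ = S₁₄
poly s₁₅ = S₁₅

Irreducible-test : Poly → Set
Irreducible-test P = P ≢ 0ₚ × P ≢ 1ₚ × ¬ HasSmallFactor P

irreducible-test? : ∀ P → Dec (Irreducible-test P)
irreducible-test? P = ¬? (P ≟ 0ₚ) ×-dec ¬? (P ≟ 1ₚ) ×-dec ¬? (hasSmallFactor? P)

abstract
  primes-irreducible : All (Irreducible-test ∘ poly) primes
  primes-irreducible = toWitness {a? = all? (irreducible-test? ∘ poly) primes} _

poly-irreducible : ∀ i → Irreducible (poly i)
poly-irreducible i = go (for-primes primes-irreducible i)
  where
  go : Irreducible-test (poly i) → Irreducible (poly i)
  go (P≢0 , P≢1 , none) = ¬smallFactor⇒irreducible (poly i) (P≢0 , P≢1) none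

Distinct : Prime → Prime → Set
Distinct i j = poly i ≢ poly j

abstract
  primes-distinct : AllPairs Distinct primes
  primes-distinct = toWitness {a? = allPairs? (λ i j → ¬? (poly i ≟ poly j)) primes} _

prodOver : List Prime → (Prime → Poly) → Poly
prodOver is f = foldr (λ i p → f i * p) 1ₚ is

monomial : List Prime → (Prime → ℕ) → Poly
monomial is h = prodOver is (λ i → poly i ^ h i)

prodOver-cong : ∀ is {f g} → (∀ i → f i ≡ g i) → prodOver is f ≡ prodOver is g
prodOver-cong []       e = refl
prodOver-cong (i ∷ is) e = cong₂ _*_ (e i) (prodOver-cong is e)

prodOver-* : ∀ is f g → prodOver is (λ i → f i * g i) ≡ prodOver is f * prodOver is g
prodOver-* []       f g = refl
prodOver-* (i ∷ is) f g = trans (cong (f i * g i *_) (prodOver-* is f g)) (*-interchange (f i) (g i) _ _)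

prodOver-1 : ∀ is → prodOver is (λ _ → 1ₚ) ≡ 1ₚ
prodOver-1 []       = refl
prodOver-1 (i ∷ is) = prodOver-1 is

prodOver-^ : ∀ is f n → prodOver is (λ i → f i ^ n) ≡ prodOver is f ^ n
prodOver-^ []       f n = sym (1-^ n)
prodOver-^ (i ∷ is) f n = trans (cong (f i ^ n *_) (prodOver-^ is f n)) (sym (*-^ (f i) _ n))

monomial-sum : ∀ is js (e : Prime → Prime → ℕ) →
  monomial js (λ j → sumOver is (λ i → e i j)) ≡ prodOver is (λ i → monomial js (e i))
monomial-sum []       js e = prodOver-1 js
monomial-sum (i ∷ is) js e = begin
  monomial js (λ j → e i j ℕ.+ sumOver is (λ i → e i j))
    ≡⟨ prodOver-cong js (λ j → ^-+ (poly j) (e i j) _) ⟩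
  prodOver js (λ j → poly j ^ e i j * poly j ^ sumOver is (λ i → e i j))
    ≡⟨ prodOver-* js (λ j → poly j ^ e i j) (λ j → poly j ^ sumOver is (λ i → e i j)) ⟩
  monomial js (e i) * monomial js (λ j → sumOver is (λ i → e i j))
    ≡⟨ cong (monomial js (e i) *_) (monomial-sum is js e) ⟩
  monomial js (e i) * prodOver is (λ i → monomial js (e i)) ∎
  where open ≡-Reasoning

monomial-≢0 : ∀ is h → monomial is h ≢ 0ₚ
monomial-≢0 []       h ()
monomial-≢0 (i ∷ is) h = *-≢0 (^-≢0 (h i) (proj₁ (proj₁ (poly-irreducible i)))) (monomial-≢0 is h)

∤-monomial : ∀ {Q} → Irreducible Q → ∀ is h → All (λ j → Q ≢ poly j) is → ¬ Q ∣ monomial is h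
∤-monomial {Q} irr []       h []       d = proj₂ (proj₁ irr) (∣1⇒≡1 Q d)
∤-monomial {Q} irr (i ∷ is) h (n ∷ ns) d with euclid irr (poly i ^ h i) (monomial is h) d
... | inj₁ d′ = n (irreducible-∣ irr (poly-irreducible i) (euclid-^ irr (poly i) (h i) d′))
... | inj₂ d′ = ∤-monomial irr is h ns d′

val-monomial : ∀ is h → AllPairs Distinct is → ∀ {i} → i ∈ is → Val (poly i) (monomial is h) (h i)
val-monomial (i ∷ is) h (ds ∷ _) (here refl) =
  monomial is h , refl , ∤-monomial (poly-irreducible i) is h ds
val-monomial (j ∷ is) h (ds ∷ dis) {i} (there i∈) =
  val-* (poly-irreducible i) {k = 0} {l = h i}
    (val-0 (poly-irreducible i) (λ d → All.lookup ds i∈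
      (sym (irreducible-∣ (poly-irreducible i) (poly-irreducible j) (euclid-^ (poly-irreducible i) (poly j) (h j) d)))))
    (val-monomial is h dis i∈)

-- The exponents are the valuations at pairwise distinct primes. This is what turns σ(A) = A into
-- the balance equations.
monomial-injective : ∀ h h′ → monomial primes h ≡ monomial primes h′ → ∀ i → h i ≡ h′ i
monomial-injective h h′ e i = val-unique (poly-irreducible i) {k = h i} {l = h′ i}
  (val-monomial primes h primes-distinct (∈-primes i))
  (subst (λ A → Val (poly i) A (h′ i)) (sym e) (val-monomial primes h′ primes-distinct (∈-primes i)))

FactorsOver : List Prime → Poly → Set
FactorsOver is A = ∀ Q → Irreducible Q → Q ∣ A → ∃ λ i → i ∈ is × Q ≡ poly i

-- One prime power is split off at a time. After the last one the cofactor has no irreducible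
-- divisor left, hence is 1.
factorise : ∀ is h A → AllPairs Distinct is → A ≢ 0ₚ → FactorsOver is A →
  (∀ {i} → i ∈ is → Val (poly i) A (h i)) → A ≡ monomial is h
factorise [] h A _ A≢0 fac vals with A ≟ 1ₚ
... | yes A≡1 = A≡1
... | no A≢1 with Q , irr , d ← ∃-irreducible-∣ A (A≢0 , A≢1) with () ← proj₁ (proj₂ (fac Q irr d))
factorise (i ∷ is) h A (ds ∷ dis) A≢0 fac vals with B , refl , nd ← vals (here refl) =
  cong (poly i ^ h i *_) (factorise is h B dis B≢0 facB valsB)
  where
  B≢0 = *-≢0ʳ (poly i ^ h i) B A≢0
  facB : FactorsOver is B
  facB Q irr d with fac Q irr (∣-*ˡ {Q} (poly i ^ h i) d)
  ... | j , here refl , refl = ⊥-elim (nd d)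
  ... | j , there j∈  , e    = j , j∈ , e
  valsB : ∀ {j} → j ∈ is → Val (poly j) B (h j)
  valsB {j} j∈ with k , v ← val-exists (poly-irreducible j) B B≢0 =
    subst (Val (poly j) B) (val-unique (poly-irreducible j) {k = k} {l = h j}
      (val-* (poly-irreducible j) {k = 0} {l = k} (val-0 (poly-irreducible j) (λ d → All.lookup ds j∈
        (sym (irreducible-∣ (poly-irreducible j) (poly-irreducible i) (euclid-^ (poly-irreducible j) (poly i) (h i) d))))) v)
      (vals (there j∈))) v

Smooth : Poly → Set
Smooth A = ∀ Q → Irreducible Q → Q ∣ A → ∃ λ i → Q ≡ poly i

smooth⇒monomial : ∀ A → A ≢ 0ₚ → Smooth A → ∃ λ h → A ≡ monomial primes h
smooth⇒monomial A A≢0 sm = h , factorise primes h A primes-distinct A≢0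
    (λ Q irr d → let i , e = sm Q irr d in i , ∈-primes i , e)
    (λ {i} _ → proj₂ (val-exists (poly-irreducible i) A A≢0))
  where
  h : Prime → ℕ
  h i = proj₁ (val-exists (poly-irreducible i) A A≢0)

sigma-monomial : ∀ is h → AllPairs Distinct is →
  SigmaIs (monomial is h) (prodOver is (λ i → geom (poly i) (h i)))
sigma-monomial []       h _          = sigma-1
sigma-monomial (i ∷ is) h (ds ∷ dis) =
  sigma-step (poly-irreducible i) (monomial-≢0 is h) (∤-monomial (poly-irreducible i) is h ds)
    (sigma-monomial is h dis) (h i)

-- σ(P^(k-1)) has a factor coprime to all allowed primes for every k ∈ bad P.
bad : Prime → List ℕ
bad x₀ = 17 ∷ 31 ∷ 73 ∷ 127 ∷ 21 ∷ 25 ∷ 27 ∷ 35 ∷ 39 ∷ 45 ∷ 49 ∷ 65 ∷ 91 ∷ 169 ∷ []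
bad x₁ = 17 ∷ 31 ∷ 73 ∷ 127 ∷ 21 ∷ 25 ∷ 27 ∷ 35 ∷ 39 ∷ 45 ∷ 49 ∷ 65 ∷ 91 ∷ 169 ∷ []
bad m₁ = 9 ∷ 13 ∷ 17 ∷ 31 ∷ 73 ∷ 127 ∷ 21 ∷ 25 ∷ 35 ∷ 49 ∷ []
bad m₂ = 5 ∷ 7 ∷ 9 ∷ 13 ∷ 17 ∷ 31 ∷ 73 ∷ 127 ∷ []
bad m₃ = 5 ∷ 7 ∷ 9 ∷ 13 ∷ 17 ∷ 31 ∷ 73 ∷ 127 ∷ []
bad s₁ = 5 ∷ 7 ∷ 9 ∷ 13 ∷ 17 ∷ 31 ∷ 73 ∷ 127 ∷ []
bad s₂ = 5 ∷ 7 ∷ 9 ∷ 13 ∷ 17 ∷ 31 ∷ 73 ∷ 127 ∷ []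
bad _  = 3 ∷ 5 ∷ 7 ∷ 13 ∷ 17 ∷ 31 ∷ 73 ∷ 127 ∷ []

Factors-1+poly : Prime → Set
Factors-1+poly i = 1ₚ + poly i ≡ monomial primes (base i)

Factors-geom : Prime → Set
Factors-geom i = All (λ g → geom (poly i) (g ∸ 1) ≡ monomial primes (λ j → occurs (hits i j) g)) (good i)

factors-1+poly? : ∀ i → Dec (Factors-1+poly i)
factors-1+poly? i = 1ₚ + poly i ≟ monomial primes (base i)

factors-geom? : ∀ i → Dec (Factors-geom i)
factors-geom? i = all? (λ g → geom (poly i) (g ∸ 1) ≟ monomial primes (λ j → occurs (hits i j) g)) (good i)

abstract
  all-1+poly : All Factors-1+poly primes
  all-1+poly = toWitness {a? = all? factors-1+poly? primes} _

  all-geom-good : All Factors-geom primes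
  all-geom-good = toWitness {a? = all? factors-geom? primes} _

-- Excluding exponents

-- All that is proved is that the result divides A; roughness is tested separately, so the number of
-- rounds limits the reach of the test and not its correctness.
strip : ℕ → Poly → Poly → Poly
strip′ : ℕ → Poly → Poly → Poly × Poly → Poly
strip zero    Q A = A
strip (suc n) Q A = strip′ n Q A (divMod A Q)
strip′ n Q A (c , 0ₚ)    = strip n Q c
strip′ n Q A (c , ⟨ _ ⟩) = A

strip-∣ : ∀ n Q A → Q ≢ 0ₚ → strip n Q A ∣ A
strip-∣ zero    Q A Q≢0 = ∣-refl
strip-∣ (suc n) Q A Q≢0 = go (divMod A Q) (divMod-correct A Q Q≢0)
  where
  go : ∀ cr → IsDivMod A Q cr → strip′ n Q A cr ∣ A
  go (c , 0ₚ)    (e , _) = ∣-trans {strip n Q c} {c} (strip-∣ n Q c Q≢0)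
    (Q , trans (*-comm c Q) (trans (sym (+-identityʳ (Q * c))) (sym e)))
  go (c , ⟨ _ ⟩) _       = ∣-refl

stripAll : List Prime → Poly → Poly
stripAll is A = foldr (λ i → strip 20 (poly i)) A is

stripAll-∣ : ∀ is A → stripAll is A ∣ A
stripAll-∣ []       A = ∣-refl
stripAll-∣ (i ∷ is) A = ∣-trans {stripAll (i ∷ is) A} {stripAll is A}
  (strip-∣ 20 (poly i) (stripAll is A) (proj₁ (proj₁ (poly-irreducible i)))) (stripAll-∣ is A)

Rough : Poly → Set
Rough W = W ≢ 0ₚ × W ≢ 1ₚ × All (λ i → ¬ poly i ∣ W) primes

rough? : ∀ W → Dec (Rough W)
rough? W = ¬? (W ≟ 0ₚ) ×-dec ¬? (W ≟ 1ₚ) ×-dec all? (λ i → ¬? (poly i ∣? W)) primes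

smooth-∤ : ∀ {A W} → Smooth A → Rough W → ¬ W ∣ A
smooth-∤ {A} {W} sm (W≢0 , W≢1 , none) W∣A
  with Q , irr , Q∣W ← ∃-irreducible-∣ W (W≢0 , W≢1)
  with i , refl ← sm Q irr (∣-trans {Q} {W} Q∣W W∣A) = for-primes none i Q∣W

-- Horner evaluation of `geom P k` with a reduction modulo W at each step, so polynomials of large
-- degree are never formed.
residue : Poly → Poly → ℕ → Poly
residue W P zero    = 1ₚ
residue W P (suc k) = (1ₚ + P * residue W P k) mod W

∣-geom+residue : ∀ W P → W ≢ 0ₚ → ∀ k → W ∣ geom P k + residue W P k
∣-geom+residue W P W≢0 zero    = ∣-0 W
∣-geom+residue W P W≢0 (suc k) = subst (W ∣_)
  (+-cancel-middle (1ₚ + P * g) (1ₚ + P * r) ((1ₚ + P * r) mod W))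
  (∣-+ {W} (subst (W ∣_) eq (∣-*ˡ {W} P (∣-geom+residue W P W≢0 k))) (mod-∣ (1ₚ + P * r) W W≢0))
  where
  open ≡-Reasoning
  g = geom P k
  r = residue W P k
  eq : P * (g + r) ≡ (1ₚ + P * g) + (1ₚ + P * r)
  eq = begin
    P * (g + r)                       ≡⟨ *-distribˡ-+ P g r ⟩
    P * g + P * r                     ≡⟨ sym (+-cancel-middle (P * g) 1ₚ (P * r)) ⟩
    (P * g + 1ₚ) + (1ₚ + P * r)       ≡⟨ cong (_+ (1ₚ + P * r)) (+-comm (P * g) 1ₚ) ⟩
    (1ₚ + P * g) + (1ₚ + P * r)       ∎

-- Since 2⁵ - 1 = 31 and 2⁷ - 1 = 127 are prime, any W of degree 5 or 7 serves unless P is 0 or 1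
-- modulo W; the degree 9 candidates are those modulo which the primes have order 73.
candidates : ℕ → List Poly
candidates k =
  if k ≡ᵇ 31  then 1ₚ + x + x ^ 2 + x ^ 3 + x ^ 5 ∷ [] else
  if k ≡ᵇ 127 then 1ₚ + x + x ^ 2 + x ^ 3 + x ^ 7 ∷ [] else
  if k ≡ᵇ 73  then order73 else []
  where
  order73 =
    1ₚ + x + x ^ 3 + x ^ 4 + x ^ 9 ∷
    1ₚ + x + x ^ 3 + x ^ 6 + x ^ 9 ∷
    1ₚ + x ^ 5 + x ^ 6 + x ^ 8 + x ^ 9 ∷
    1ₚ + x + x ^ 4 + x ^ 5 + x ^ 6 + x ^ 8 + x ^ 9 ∷
    1ₚ + x + x ^ 4 + x ^ 5 + x ^ 9 ∷
    1ₚ + x + x ^ 5 + x ^ 6 + x ^ 7 + x ^ 8 + x ^ 9 ∷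
    1ₚ + x ^ 3 + x ^ 5 + x ^ 6 + x ^ 7 + x ^ 8 + x ^ 9 ∷
    1ₚ + x ^ 2 + x ^ 4 + x ^ 7 + x ^ 9 ∷
    1ₚ + x + x ^ 3 + x ^ 4 + x ^ 6 + x ^ 8 + x ^ 9 ∷ []

-- Two sources of a rough divisor: a listed W, tested through residues for the large k, or what
-- remains of the geometric sum after the allowed primes are divided out.
Excluded : Prime → ℕ → Set
Excluded i k =
  Any (λ W → residue W (poly i) (k ∸ 1) ≡ 0ₚ × Rough W) (candidates k) ⊎
  Rough (stripAll primes (geom (poly i) (k ∸ 1)))

excluded? : ∀ i k → Dec (Excluded i k)
excluded? i k =
  any? (λ W → (residue W (poly i) (k ∸ 1) ≟ 0ₚ) ×-dec rough? W) (candidates k) ⊎-dec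
  rough? (stripAll primes (geom (poly i) (k ∸ 1)))

excluded⇒rough : ∀ i k → Excluded i k → ∃ λ W → Rough W × W ∣ geom (poly i) (k ∸ 1)
excluded⇒rough i k (inj₁ some) with W , _ , r≡0 , rough ← find some =
  W , rough , subst (W ∣_) (trans (cong (geom (poly i) (k ∸ 1) +_) r≡0) (+-identityʳ _))
    (∣-geom+residue W (poly i) (proj₁ rough) (k ∸ 1))
excluded⇒rough i k (inj₂ rough) = _ , rough , stripAll-∣ primes (geom (poly i) (k ∸ 1))

-- The product is a multiple of 2ᵏ - 1 for the degree k of every allowed prime; 9 ∣ 2⁶ - 1.
oddPrimes : List ℕ
oddPrimes = 3 ∷ 3 ∷ 5 ∷ 7 ∷ 13 ∷ 17 ∷ 31 ∷ 73 ∷ 127 ∷ []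

-- Enlarging a good divisor of u by one more prime gives a good divisor or runs into a bad one, so
-- the growth never leaves the finite list.
Closed : Prime → Set
Closed i = All (λ g → All (λ r → g ℕ.* r ∈ good i ⊎ Any (_∣ℕ g ℕ.* r) (bad i)) oddPrimes) (good i)

closed? : ∀ i → Dec (Closed i)
closed? i = all? (λ g → all? (λ r → g ℕ.* r ∈ℕ? good i ⊎-dec any? (_∣ℕ? g ℕ.* r) (bad i)) oddPrimes) (good i)

-- The two inputs of the order argument modulo P of degree d: the congruence that `fermat` asks for,
-- and that the exponent 2^d - 1 divides the product of `oddPrimes`.
Splitting : Prime → Set
Splitting i = poly i ∣ X ^ (2 ℕ.^ deg (poly i)) + X × (2 ℕ.^ deg (poly i) ∸ 1) ∣ℕ product oddPrimes

splitting? : ∀ i → Dec (Splitting i)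
splitting? i = (poly i ∣? X ^ (2 ℕ.^ deg (poly i)) + X) ×-dec ((2 ℕ.^ deg (poly i) ∸ 1) ∣ℕ? product oddPrimes)

abstract
  bad-excluded : All (λ i → All (Excluded i) (bad i)) primes
  bad-excluded = toWitness {a? = all? (λ i → all? (excluded? i) (bad i)) primes} _

  good-closed : All Closed primes
  good-closed = toWitness {a? = all? closed? primes} _

  primes-splitting : All Splitting primes
  primes-splitting = toWitness {a? = all? splitting? primes} _

  oddPrimes-prime : All Primeℕ oddPrimes
  oddPrimes-prime = toWitness {a? = all? prime? oddPrimes} _

-- From perfect polynomials to the exponent system

fermat-multiple : ∀ {Q} → Irreducible Q → ∀ k → Q ∣ X ^ (2 ℕ.^ k) + X → ∀ {n} → (2 ℕ.^ k ∸ 1) ∣ℕ n →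
  ∀ p → ¬ Q ∣ p → Q ∣ 1ₚ + p ^ n
fermat-multiple {Q} irr k fixX (divides c refl) p nd =
  subst (λ t → Q ∣ 1ₚ + t) (sym (^-* p c (2 ℕ.^ k ∸ 1))) (∣1+^ Q (p ^ (2 ℕ.^ k ∸ 1)) c (fermat irr k fixX p nd))

common-prime : ∀ Q p u rs → All Primeℕ rs → ¬ Q ∣ 1ₚ + p → Q ∣ 1ₚ + p ^ product rs → Q ∣ 1ₚ + p ^ u →
  Any (_∣ℕ u) rs
common-prime Q p u rs prs nd dr du with any? (_∣ℕ? u) rs
... | yes some = some
... | no  none = ⊥-elim (nd (∣1+-product Q u rs prs (¬Any⇒All¬ rs none) p dr du))

-- If Q ∣ geom Y m then Y has order > 1 in (𝔽₂[x]/Q)ˣ, dividing both m + 1 and product oddPrimes.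
geom-oddPrime : ∀ {A Y m} → Smooth A → NonConstant Y → 0 < m → Oddℕ (suc m) → geom Y m ∣ A →
  ∃ λ r → r ∈ oddPrimes × r ∣ℕ suc m
geom-oddPrime {A} {Y} {m} sm nc 0<m odd g∣A
  with Q , irr , Q∣g ← ∃-irreducible-∣ (geom Y m) (geom-nonConstant nc m 0<m)
  with i , refl ← sm Q irr (∣-trans {Q} {geom Y m} Q∣g g∣A)
  = find (common-prime (poly i) Y (suc m) oddPrimes oddPrimes-prime Q∤1+Y
      (fermat-multiple irr (deg (poly i)) (proj₁ (for-primes primes-splitting i)) (proj₂ (for-primes primes-splitting i)) Y Q∤Y)
      (subst (poly i ∣_) (geom-telescope Y m) (∣-*ˡ {poly i} (1ₚ + Y) Q∣g)))
  where
  Q≢1 : poly i ≢ 1ₚ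
  Q≢1 = proj₂ (proj₁ irr)
  pred : 0 < m → ∃ λ m′ → m ≡ suc m′
  pred (s≤s {n = m′} _) = m′ , refl
  -- Modulo Y the geometric sum is 1.
  Q∤Y : ¬ poly i ∣ Y
  Q∤Y d with m′ , refl ← pred 0<m = Q≢1 (∣1⇒≡1 (poly i)
    (∣-+-cancelˡ {poly i} (Y * geom Y m′) 1ₚ (∣-*ʳ {poly i} (geom Y m′) d)
      (subst (poly i ∣_) (+-comm 1ₚ (Y * geom Y m′)) Q∣g)))
  -- Modulo 1 + Y the sum consists of m + 1 ones; as m + 1 is odd, it is 1.
  Q∤1+Y : ¬ poly i ∣ 1ₚ + Y
  Q∤1+Y d with k , refl ← odd-suc odd = Q≢1 (∣1⇒≡1 (poly i)
    (∣-+-cancelˡ {poly i} (geom Y (k ℕ.+ k)) 1ₚ Q∣g (∣-trans {poly i} {1ₚ + Y} d (∣1+geom-even Y k))))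

nonConstant : ∀ i → NonConstant (poly i)
nonConstant i = proj₁ (poly-irreducible i)

odd-*ʳ : ∀ m n → Oddℕ (m ℕ.* n) → Oddℕ n
odd-*ʳ m n odd d = odd (ℕ∣.∣n⇒∣m*n m d)

-- If k divides v + 1, then σ(P^(k-1)) divides σ(P^v), hence A, and so does its rough factor.
good-excludes : ∀ {A} → Smooth A → ∀ i v → geom (poly i) v ∣ A → ¬ Any (_∣ℕ suc v) (bad i)
good-excludes {A} sm i v g∣A some
  with k , k∈ , divides c e ← find some
  = absurd k c e (excluded⇒rough i k (All.lookup (for-primes bad-excluded i) k∈))
  where
  absurd : ∀ k c → suc v ≡ c ℕ.* k → (∃ λ W → Rough W × W ∣ geom (poly i) (k ∸ 1)) → ⊥
  absurd zero    c       e _ with () ← trans e (ℕₚ.*-zeroʳ c)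
  absurd (suc k) zero    () _
  absurd (suc k) (suc c) e (W , rough , W∣g) = smooth-∤ sm rough (∣-trans {W} {geom (poly i) v}
    (subst (W ∣_) (sym (geom-* (nonConstant i) k c v (trans e (ℕₚ.*-comm (suc c) (suc k))))) (∣-*ʳ {W} _ W∣g)) g∣A)

-- Starting from 1 ∈ good i, the divisor g of u is multiplied by primes of u until it equals u.
good-exponent : ∀ {A} → Smooth A → ∀ i v → Oddℕ (suc v) → geom (poly i) v ∣ A → suc v ∈ good i
good-exponent {A} sm i v odd g∣A = go (suc v) 1 (suc v) (1∈good i) (sym (ℕₚ.*-identityˡ (suc v))) ℕₚ.≤-refl
  where
  P = poly i
  1∈good : ∀ i → 1 ∈ good i
  1∈good = for-primes (toWitness {a? = all? (λ i → 1 ∈ℕ? good i) primes} _)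
  smaller : ∀ {n r} u″ → r ∈ oddPrimes → 0 < u″ ℕ.* r → u″ ℕ.* r ≤ suc n → u″ ≤ n
  smaller {n} {r} u″ r∈ 0<u le = ℕₚ.≤-pred (ℕₚ.≤-trans (ℕₚ.m<m*n u″ r {{ℕₚ.m*n≢0⇒m≢0 u″ {{ℕ.>-nonZero 0<u}}}}
    (All.lookup (toWitness {a? = all? (1 ℕ.<?_) oddPrimes} _) r∈)) le)
  go : ∀ n g u′ → g ∈ good i → suc v ≡ g ℕ.* u′ → u′ ≤ n → suc v ∈ good i
  go n zero    u′ g∈ () le
  go n (suc g) zero g∈ e le with () ← trans e (ℕₚ.*-zeroʳ (suc g))
  go n (suc g) (suc zero) g∈ e le = subst (_∈ good i) (sym (trans e (ℕₚ.*-identityʳ (suc g)))) g∈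
  -- With g′ = g + 1, σ(P^v) is σ(P^(g′-1)) times the geometric sum of u′ terms in P^g′. The order
  -- argument for Y = P^g′ yields a prime that divides the cofactor u′.
  go (suc n) (suc g) u′@(suc (suc m)) g∈ e le
    = enlarge (geom-oddPrime {A} sm (^-nonConstant g (nonConstant i)) (s≤s z≤n)
      (odd-*ʳ (suc g) u′ (subst Oddℕ e odd))
      (∣-trans {geom (P ^ suc g) (suc m)} {geom P v}
        (geom P g , trans (*-comm (geom (P ^ suc g) (suc m)) (geom P g)) (sym (geom-* (nonConstant i) g (suc m) v e)))
        g∣A))
    where
    enlarge : (∃ λ r → r ∈ oddPrimes × r ∣ℕ u′) → suc v ∈ good i
    enlarge (r , r∈ , divides u″ u′≡) = continue (All.lookup (All.lookup (for-primes good-closed i) g∈) r∈)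
      where
      e′ : suc v ≡ (suc g ℕ.* r) ℕ.* u″
      e′ = trans e (trans (cong (suc g ℕ.*_) (trans u′≡ (ℕₚ.*-comm u″ r))) (sym (ℕₚ.*-assoc (suc g) r u″)))
      continue : suc g ℕ.* r ∈ good i ⊎ Any (_∣ℕ suc g ℕ.* r) (bad i) → suc v ∈ good i
      continue (inj₁ gr∈)  = go n (suc g ℕ.* r) u″ gr∈ e′
        (smaller u″ r∈ (subst (0 <_) u′≡ (s≤s z≤n)) (subst (_≤ suc n) u′≡ le))
      continue (inj₂ some) = ⊥-elim (good-excludes sm i v g∣A
        (Any.map (λ k∣gr → ℕ∣.∣-trans k∣gr (divides u″ (trans e′ (ℕₚ.*-comm (suc g ℕ.* r) u″)))) some))

^-*′ : ∀ p m n → p ^ (m ℕ.* n) ≡ (p ^ m) ^ n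
^-*′ p m n = trans (cong (p ^_) (ℕₚ.*-comm m n)) (^-* p n m)

geom-monomial : ∀ i h → oddPart h ∈ good i → geom (poly i) h ≡ monomial primes (λ j → contribution i j h)
geom-monomial i h u∈ = go (oddPart h) u∈ (suc≡2^ν*oddPart h)
  where
  N = 2^ν h
  go : ∀ u → u ∈ good i → suc h ≡ N ℕ.* u →
    geom (poly i) h ≡ monomial primes (λ j → base i j ℕ.* (N ∸ 1) ℕ.+ occurs (hits i j) u ℕ.* N)
  go zero    _  e with () ← trans e (ℕₚ.*-zeroʳ N)
  go (suc v) u∈ e = begin
    geom (poly i) h
      ≡⟨ geom-2^ (nonConstant i) (ν h) v h e ⟩
    (1ₚ + poly i) ^ (N ∸ 1) * geom (poly i) v ^ N
      ≡⟨ cong₂ (λ p q → p ^ (N ∸ 1) * q ^ N) (for-primes all-1+poly i) (All.lookup (for-primes all-geom-good i) u∈) ⟩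
    monomial primes (base i) ^ (N ∸ 1) * monomial primes o ^ N
      ≡⟨ sym (cong₂ _*_ (prodOver-^ primes (λ j → poly j ^ base i j) (N ∸ 1)) (prodOver-^ primes (λ j → poly j ^ o j) N)) ⟩
    prodOver primes (λ j → (poly j ^ base i j) ^ (N ∸ 1)) * prodOver primes (λ j → (poly j ^ o j) ^ N)
      ≡⟨ sym (prodOver-* primes (λ j → (poly j ^ base i j) ^ (N ∸ 1)) (λ j → (poly j ^ o j) ^ N)) ⟩
    prodOver primes (λ j → (poly j ^ base i j) ^ (N ∸ 1) * (poly j ^ o j) ^ N)
      ≡⟨ prodOver-cong primes (λ j → sym (trans (^-+ (poly j) (base i j ℕ.* (N ∸ 1)) (o j ℕ.* N))
          (cong₂ _*_ (^-*′ (poly j) (base i j) (N ∸ 1)) (^-*′ (poly j) (o j) N)))) ⟩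
    monomial primes (λ j → base i j ℕ.* (N ∸ 1) ℕ.+ o j ℕ.* N) ∎
    where
    open ≡-Reasoning
    o : Prime → ℕ
    o j = occurs (hits i j) (suc v)

∣-prodOver : ∀ {is i} → i ∈ is → ∀ f → f i ∣ prodOver is f
∣-prodOver {i ∷ is} (here refl) f = prodOver is f , refl
∣-prodOver {i ∷ is} (there i∈)  f = ∣-*ˡ {f _} (f i) (∣-prodOver i∈ f)

perfect⇒balanced : ∀ {h A} → A ≡ monomial primes h → Smooth A → Perfect A → Balanced h
perfect⇒balanced {h} {A} refl sm perf = record
  { oddPart-good = u∈
  ; balance      = monomial-injective h (sigmaExponent h) (trans σ≡ (trans
      (prodOver-cong primes (λ i → geom-monomial i (h i) (u∈ i)))
      (sym (monomial-sum primes primes (λ i j → contribution i j (h i)))))) }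
  where
  σ≡ : monomial primes h ≡ prodOver primes (λ i → geom (poly i) (h i))
  σ≡ = sigma-unique perf (sigma-monomial primes h primes-distinct)
  -- σ(P^(u-1)) divides σ(P^h) because the power 2^ν is positive, and σ(P^h) divides σ(A) = A.
  u∈ : ∀ i → oddPart (h i) ∈ good i
  u∈ i = go (oddPart (h i)) (oddPart-odd (h i)) (suc≡2^ν*oddPart (h i))
    where
    go : ∀ u → Oddℕ u → suc (h i) ≡ 2^ν (h i) ℕ.* u → u ∈ good i
    go zero    odd _ = ⊥-elim (odd (divides 0 refl))
    go (suc v) odd e = good-exponent sm i v odd
      (∣-trans {geom (poly i) v} {geom (poly i) (h i)}
        (subst (geom (poly i) v ∣_) (sym (geom-2^ (nonConstant i) (ν (h i)) v (h i) e))
          (∣-*ˡ {g} ((1ₚ + poly i) ^ (N ∸ 1)) (subst (g ∣_)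
            (cong (g ^_) (ℕₚ.m+[n∸m]≡n (ℕₚ.m^n>0 2 (ν (h i)))))
            (∣-*ʳ {g} {g} (g ^ (N ∸ 1)) ∣-refl))))
        (subst (geom (poly i) (h i) ∣_) (sym σ≡) (∣-prodOver (∈-primes i) (λ i → geom (poly i) (h i)))))
      where
      g = geom (poly i) v
      N = 2^ν (h i)

-- Comparison with the list 𝓣, and indecomposability

open import Data.List.Membership.DecPropositional _≟_ using () renaming (_∈?_ to _∈ₚ?_)

solutionPoly : Triple → Poly
solutionPoly (a , b , c) = monomial primes (exponents a b c)

solutionSigma : Triple → Poly
solutionSigma (a , b , c) = prodOver primes (λ i → geom (poly i) (exponents a b c i))

abstract
  𝓕-indexed : All (λ P → Any (λ i → P ≡ poly i) primes) 𝓕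
  𝓕-indexed = toWitness {a? = all? (λ P → any? (λ i → P ≟ poly i) primes) 𝓕} _

  solution∈𝓣 : All (λ t → solutionPoly t ∈ 𝓣) solutions
  solution∈𝓣 = toWitness {a? = all? (λ t → solutionPoly t ∈ₚ? 𝓣) solutions} _

  𝓣-solutions : All (λ T → Any (λ t → solutionPoly t ≡ T) solutions) 𝓣
  𝓣-solutions = toWitness {a? = all? (λ T → any? (λ t → solutionPoly t ≟ T) solutions) 𝓣} _

  𝓣-bar : All (λ T → bar T ∈ 𝓣) 𝓣
  𝓣-bar = toWitness {a? = all? (λ T → bar T ∈ₚ? 𝓣) 𝓣} _

  solutions-perfect : All (λ t → solutionSigma t ≡ solutionPoly t) solutions
  solutions-perfect = toWitness {a? = all? (λ t → solutionSigma t ≟ solutionPoly t) solutions} _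

  solutions-x₀ : All (λ t → 0 < proj₁ t) solutions
  solutions-x₀ = toWitness {a? = all? (λ t → 0 ℕ.<? proj₁ t) solutions} _

OddPartOver𝓕 : Poly → Set
OddPartOver𝓕 A = ∀ P → Irreducible P → Odd P → P ∣ A → P ∈ 𝓕

over𝓕⇒smooth : ∀ {A} → OddPartOver𝓕 A → Smooth A
over𝓕⇒smooth over Q irr d with X ∣? Q | (X + 1ₚ) ∣? Q
... | yes x∣Q | _        = x₀ , sym (irreducible-∣ (poly-irreducible x₀) irr x∣Q)
... | no _    | yes x+1∣Q = x₁ , sym (irreducible-∣ (poly-irreducible x₁) irr x+1∣Q)
... | no nx   | no nx+1 = let i , _ , e = find (All.lookup 𝓕-indexed (over Q irr (proj₁ (proj₁ irr) , nx , nx+1) d)) in i , e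

perfect⇒solution : ∀ {A} → A ≢ 0ₚ → Smooth A → Perfect A → ∃ λ h → A ≡ monomial primes h × Solution h
perfect⇒solution {A} A≢0 sm perf with h , e ← smooth⇒monomial A A≢0 sm =
  h , e , balanced⇒solution (perfect⇒balanced e sm perf)

∤⇐exponent-0 : ∀ h i → h i ≡ 0 → ¬ poly i ∣ monomial primes h
∤⇐exponent-0 h i e d = go (h i) e (val-monomial primes h primes-distinct (∈-primes i))
  where
  go : ∀ k → k ≡ 0 → ¬ Val (poly i) (monomial primes h) k
  go .0 refl (B , A≡B , nd) = nd (subst (poly i ∣_) A≡B d)

∣⇐exponent-pos : ∀ h i → 0 < h i → poly i ∣ monomial primes h
∣⇐exponent-pos h i pos = ∣-trans {poly i} {poly i ^ h i} (go (h i) pos) (∣-prodOver (∈-primes i) (λ i → poly i ^ h i))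
  where
  go : ∀ k → 0 < k → poly i ∣ poly i ^ k
  go (suc k) _ = poly i ^ k , refl

splitting⇒Splits : ∀ {A} h → A ≡ monomial primes h → Even A → Smooth A →
  (∀ {i} → i ∈ m₁∷outer → h i ≡ 0) → Splits A
splitting⇒Splits {A} h refl even sm outer0 = even , length L ,
  (L , Uniqueₚ.filter⁺ (_∣? A) unique , (λ P → mk⇔ (to P) (from P)) , refl) ,
  length-filter (_∣? A) linear
  where
  linear L : List Poly
  linear = X ∷ X + 1ₚ ∷ []
  L      = filter (_∣? A) linear
  unique : Unique linear
  unique = ((λ ()) ∷ []) ∷ [] ∷ []
  to : ∀ P → P ∈ L → Irreducible P × P ∣ A
  to P P∈ with ∈-filter⁻ (_∣? A) {xs = linear} P∈
  ... | here refl         , d = poly-irreducible x₀ , d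
  ... | there (here refl) , d = poly-irreducible x₁ , d
  from : ∀ P → Irreducible P × P ∣ A → P ∈ L
  from P (irr , d) with i , refl ← sm P irr d = ∈-filter⁺ (_∣? A) (go (∈-primes i)) d
    where
    go : i ∈ primes → poly i ∈ linear
    go (here refl)         = here refl
    go (there (here refl)) = there (here refl)
    go (there (there i∈))  = ⊥-elim (∤⇐exponent-0 h i (outer0 i∈) d)

-- In each sporadic triple the exponent of x is positive; in the splitting case exponent 0 at x
-- would make all exponents 0 and the product 1.
solution⇒x∣ : ∀ h → monomial primes h ≢ 1ₚ → Solution h → X ∣ monomial primes h
solution⇒x∣ h ≢1 (sporadic t∈ h≗) =
  ∣⇐exponent-pos h x₀ (subst (0 <_) (sym (h≗ x₀)) (All.lookup solutions-x₀ t∈))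
solution⇒x∣ h ≢1 (splitting x₀≡x₁ outer0) = ∣⇐exponent-pos h x₀ (ℕₚ.n≢0⇒n>0 λ e →
  ≢1 (trans (prodOver-cong primes (λ i → cong (poly i ^_) (zeros e (∈-primes i)))) (prodOver-1 primes)))
  where
  zeros : h x₀ ≡ 0 → ∀ {i} → i ∈ primes → h i ≡ 0
  zeros e (here refl)         = e
  zeros e (there (here refl)) = trans (sym x₀≡x₁) e
  zeros e (there (there i∈))  = outer0 i∈

-- Meant for the coprime factors of A, which could split even though A does not; so both kinds of
-- solution matter here.
perfect⇒x∣ : ∀ {B} → NonConstant B → Smooth B → Perfect B → X ∣ B
perfect⇒x∣ {B} (B≢0 , B≢1) sm perf = go (perfect⇒solution B≢0 sm perf)
  where
  go : (∃ λ h → B ≡ monomial primes h × Solution h) → X ∣ B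
  go (h , e , sol) = subst (X ∣_) (sym e) (solution⇒x∣ h (B≢1 ∘ trans e) sol)

smooth-∣ : ∀ {A} B → Smooth A → B ∣ A → Smooth B
smooth-∣ B sm B∣A Q irr Q∣B = sm Q irr (∣-trans {Q} {B} Q∣B B∣A)

solution-perfect : ∀ {t} → t ∈ solutions → Perfect (solutionPoly t)
solution-perfect {t@(a , b , c)} t∈ = subst (SigmaIs (solutionPoly t)) (All.lookup solutions-perfect t∈)
  (sigma-monomial primes (exponents a b c) primes-distinct)

∈𝓣⇒perfect : ∀ {A} → A ∈ 𝓣 → Perfect A
∈𝓣⇒perfect {A} A∈𝓣 = go (find (All.lookup 𝓣-solutions A∈𝓣))
  where
  go : (∃ λ t → t ∈ solutions × solutionPoly t ≡ A) → Perfect A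
  go (t , t∈ , e) = subst Perfect e (solution-perfect t∈)

theorem1p1 : (A : Poly) → Even A → ¬ Splits A →
    (∀ P → Irreducible P → Odd P → P ∣ A → P ∈ 𝓕) →
    (IndecomposablePerfect A ⇔ (A ∈ 𝓣 × bar A ∈ 𝓣))
theorem1p1 A even ¬splits over = mk⇔ forward backward
  where
  sm : Smooth A
  sm = over𝓕⇒smooth over
  forward : IndecomposablePerfect A → A ∈ 𝓣 × bar A ∈ 𝓣
  forward (perf , _) = go (perfect⇒solution (proj₁ even) sm perf)
    where
    go : (∃ λ h → A ≡ monomial primes h × Solution h) → A ∈ 𝓣 × bar A ∈ 𝓣
    go (h , e , splitting _ outer0) = ⊥-elim (¬splits (splitting⇒Splits h e even sm outer0))
    go (h , e , sporadic t∈ h≗)     = A∈𝓣 , All.lookup 𝓣-bar A∈𝓣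
      where
      A∈𝓣 : A ∈ 𝓣
      A∈𝓣 = subst (_∈ 𝓣) (sym (trans e (prodOver-cong primes (λ i → cong (poly i ^_) (h≗ i))))) (All.lookup solution∈𝓣 t∈)
  backward : A ∈ 𝓣 × bar A ∈ 𝓣 → IndecomposablePerfect A
  backward (A∈𝓣 , _) = ∈𝓣⇒perfect A∈𝓣 , indecomposable
    where
    x≢1 : X ≢ 1ₚ
    x≢1 ()
    indecomposable : ¬ (∃ λ B → ∃ λ C → A ≡ B * C × Coprime B C ×
      NonConstant B × NonConstant C × Perfect B × Perfect C)
    -- B and C divide A and so inherit its restriction on prime factors; hence x divides both.
    indecomposable (B , C , e , coprime , ncB , ncC , perfB , perfC) =
      x≢1 (coprime X (λ ())
        (perfect⇒x∣ ncB (smooth-∣ B sm (C , sym e)) perfB)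
        (perfect⇒x∣ ncC (smooth-∣ C sm (B , trans (*-comm C B) (sym e))) perfC))
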